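{- For every integer $\Delta \geq 29$, $$2^{\frac{\Delta}{2}} \leq \chi_o(\mathcal{G}^{\rm c}_{\Delta}) \leq (\Delta-3) \cdot (\Delta-1) \cdot 2^{\Delta} +2.$$
   Context: An oriented graph is a loopless directed graph without opposite arcs (an orientation $\overrightarrow{G}$ of a simple undirected graph $G$). For oriented graphs $\overrightarrow{G},\overrightarrow{H}$, a homomorphism is a map $\phi:V(\overrightarrow{G})\to V(\overrightarrow{H})$ such that every arc $uv$ of $\overrightarrow{G}$ is mapped to an arc $\phi(u)\phi(v)$ of $\overrightarrow{H}$. The oriented chromatic number $\chi_o(\overrightarrow{G})$ is the minimum number of vertices of an oriented graph $\overrightarrow{H}$ admitting a homomorphism from $\overrightarrow{G}$. For an undirected graph $G$, $\chi_o(G)$ is the maximum of $\chi_o(\overrightarrow{G})$ over all orientations $\overrightarrow{G}$ of $G$, and for a family $\mathcal{F}$ of graphs, $\chi_o(\mathcal{F})=\max\{\chi_o(G): G\in\mathcal{F}\}$. $\mathcal{G}^{\rm c}_{\Delta}$ denotes the family of connected graphs with maximum degree $\Delta$. -}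

module Defs where

open import Data.Nat using (ℕ; _≤_; _*_; _^_)
open import Data.Fin using (Fin)
open import Data.Bool using (Bool; true; false; _∨_)
open import Data.List using (List; length; filterᵇ; allFin)
open import Data.Product using (Σ; _×_; ∃)
open import Relation.Binary.PropositionalEquality using (_≡_)

record OGraph (n : ℕ) : Set where
  field
    arc    : Fin n → Fin n → Bool
    noLoop : ∀ u → arc u u ≡ false
    noOpp  : ∀ u v → arc u v ≡ true → arc v u ≡ false
open OGraph public

adj : ∀ {n} → OGraph n → Fin n → Fin n → Bool
adj G u v = arc G u v ∨ arc G v u

deg : ∀ {n} → OGraph n → Fin n → ℕ
deg {n} G u = length (filterᵇ (adj G u) (allFin n))

MaxDegree : ∀ {n} → OGraph n → ℕ → Set
MaxDegree G Δ = (∀ u → deg G u ≤ Δ) × ∃ λ u → deg G u ≡ Δ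

data Reachable {n} (G : OGraph n) : Fin n → Fin n → Set where
  here : ∀ {u} → Reachable G u u
  step : ∀ {u v w} → adj G u v ≡ true → Reachable G v w → Reachable G u w

Connected : ∀ {n} → OGraph n → Set
Connected {n} G = ∀ (u v : Fin n) → Reachable G u v

IsHom : ∀ {n m} → OGraph n → OGraph m → (Fin n → Fin m) → Set
IsHom G H φ = ∀ u v → arc G u v ≡ true → arc H (φ u) (φ v) ≡ true

-- G admits a homomorphism to some oriented graph on k vertices,
-- i.e. χ_o(G) ≤ k.
OColourable : ∀ {n} → OGraph n → ℕ → Set
OColourable {n} G k = Σ (OGraph k) λ H → Σ (Fin n → Fin k) λ φ → IsHom G H φ

-- For natural numbers Δ, k:  2^(Δ/2) ≤ k  (real exponent)  ⇔  2^Δ ≤ k².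
TwoPowHalf≤ : ℕ → ℕ → Set
TwoPowHalf≤ Δ k = 2 ^ Δ ≤ k * k

{-# OPTIONS --safe #-}

-- Upper bound.  Fix an edge uv of G and colour the other vertices one at a time,
-- so that each still has an uncoloured neighbour when its turn comes.  Colours
-- are vertices of a tournament H; the neighbours of an uncoloured vertex always
-- keep distinct colours, and u, v receive private colours at the end.  With
-- k = Δ - 1, a vertex having i ≤ k coloured neighbours must avoid at most
-- (Δ - i)(Δ - 2) colours, so H is good enough if every signed k-set of vertices
-- is matched by at least k vertices: adding an element to the set splits its
-- matching vertices, so smaller sets are matched by 2^(k-i) k vertices.  A random
-- tournament works: weighting a vertex by 1 if it matches and by 9 if not, the
-- expected product of the weights is ((9·2^k - 8) / 2^k) to the number of
-- vertices outside the set, and a union bound over all signed k-sets concludes.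
--
-- Lower bound.  A long bipartite strip in which left vertex i is joined to right
-- vertices i, …, i + Δ - 1 has 2^(nΔ) orientations on about 2n vertices, while
-- at most 2^(K²) K^(2n+Δ-1) of them map to a graph on K vertices.
module Submission where

open import Defs
open import Data.Bool using (Bool; true; false; T; T?; _∧_; _∨_; _xor_; not)
import Data.Bool as Bool
open import Data.Bool.ListAction using (all)
open import Data.Bool.Properties using (T-∧; T-≡; ∨-comm)
open import Data.Empty using (⊥; ⊥-elim)
open import Data.Fin using (Fin; zero; suc; _≟_; _↑ˡ_; _↑ʳ_; combine; finToFun; fromℕ; fromℕ<; funToFin; inject₁; join; remQuot; splitAt; toℕ)
import Data.Fin as Fin
open import Data.Fin.Induction using (<-weakInduction)
open import Data.Fin.Properties using (any?; all?; ¬∀⟶∃¬; combine-injective; combine-remQuot; finToFun-funToFin; funToFin-finToFin; injective⇒≤; join-splitAt; remQuot-combine; splitAt-join; splitAt-↑ˡ; splitAt-↑ʳ; toℕ-fromℕ; toℕ-fromℕ<; toℕ-injective; toℕ-inject₁; toℕ<n; ↑ʳ-injective)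
import Data.Fin.Properties as Fin
open import Data.List using (List; []; _∷_; _++_; allFin; cartesianProduct; cartesianProductWith; concatMap; filter; filterᵇ; length; map)
open import Data.List.Membership.Propositional using (_∈_; _∉_; find; lose)
open import Data.List.Membership.Propositional.Properties
open import Data.List.Properties using (length-++; length-++-sucʳ; length-filter; length-map; length-tabulate; map-∘)
open import Data.List.Relation.Unary.All using ([]; _∷_)
import Data.List.Relation.Unary.All as All
open import Data.List.Relation.Unary.AllPairs using ([]; _∷_; allPairs?)
open import Data.List.Relation.Unary.Any using (here; there)
import Data.List.Relation.Unary.Any as Any
open import Data.List.Relation.Unary.Unique.Propositional using (Unique)
import Data.List.Relation.Unary.Unique.Propositional.Properties as Unique
open import Data.Nat using (ℕ; zero; suc; _+_; _*_; _∸_; _^_; _≤_; _<_; _<ᵇ_; z≤n; s≤s; s≤s⁻¹; NonZero; >-nonZero)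
import Data.Nat as ℕ
open import Data.Nat.ListAction using (sum; product)
open import Data.Nat.Properties hiding (_≟_)
open import Data.Nat.Tactic.RingSolver using (solve-∀)
open import Data.Product using (Σ; ∃; ∃₂; _×_; _,_; proj₁; proj₂)
open import Data.Sum using (_⊎_; inj₁; inj₂)
open import Data.Sum.Properties using (inj₁-injective)
open import Data.Vec using (Vec; []; _∷_; lookup; updateAt)
open import Data.Vec.Properties using (lookup∘updateAt; lookup∘updateAt′)
open import Function using (_∘_; id; Equivalence)
open import Relation.Binary using (tri<; tri≈; tri>)
open import Relation.Binary.PropositionalEquality
open import Relation.Nullary using (¬_; Dec; yes; no; does; contradiction; ¬?; _×-dec_)
open import Relation.Nullary.Decidable using (dec-true; dec-false; decidable-stable)
open import Relation.Unary using (Decidable)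

-- Lists and finite sums

private variable
  A B : Set

-- Pigeonhole by induction: one occurrence of `f x` is cut out of `ys`, and injectivity keeps the
-- other images in what remains.
length-≤-injectiveOn : ∀ (f : A → B) {xs : List A} {ys : List B} → Unique xs →
  (∀ {x y} → x ∈ xs → y ∈ xs → f x ≡ f y → x ≡ y) →
  (∀ {x} → x ∈ xs → f x ∈ ys) → length xs ≤ length ys
length-≤-injectiveOn f {[]} _ _ _ = z≤n
length-≤-injectiveOn f {x ∷ xs} {ys} (x∉ ∷ uniq) inj into
  with ∈-∃++ (into (here refl))
... | as , bs , refl =
  ≤-trans (s≤s (length-≤-injectiveOn f uniq (λ p q → inj (there p) (there q)) into′))
          (≤-reflexive (sym (length-++-sucʳ as (f x) bs)))
  where
  into′ : ∀ {y} → y ∈ xs → f y ∈ as ++ bs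
  into′ y∈ with ∈-++⁻ as (into (there y∈))
  ... | inj₁ p = ∈-++⁺ˡ p
  ... | inj₂ (there p) = ∈-++⁺ʳ as p
  ... | inj₂ (here e) = contradiction (inj (here refl) (there y∈) (sym e)) (All.lookup x∉ y∈)

length-≤-⊆ : {xs ys : List A} → Unique xs → (∀ {x} → x ∈ xs → x ∈ ys) → length xs ≤ length ys
length-≤-⊆ uniq = length-≤-injectiveOn id uniq (λ _ _ e → e)

module _ {n : ℕ} where
  open import Data.List.Membership.DecPropositional (Fin._≟_ {n}) using (_∈?_)

  longer⇒∃∉ : {xs ys : List (Fin n)} → Unique xs → length ys < length xs →
    ∃ λ x → x ∈ xs × x ∉ ys
  longer⇒∃∉ {xs} {ys} uniq lt with Any.any? (λ x → ¬? (x ∈? ys)) xs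
  ... | yes p = find p
  ... | no ¬p = contradiction (length-≤-⊆ uniq inside) (<⇒≱ lt)
    where
    inside : ∀ {x} → x ∈ xs → x ∈ ys
    inside {x} x∈ = decidable-stable (x ∈? ys) λ x∉ → ¬p (Any.map (λ { refl → x∉ }) x∈)

length-filter-∁ : ∀ {P : A → Set} (P? : Decidable P) xs →
  length (filter P? xs) + length (filter (¬? ∘ P?) xs) ≡ length xs
length-filter-∁ P? [] = refl
length-filter-∁ P? (x ∷ xs) with P? x
... | yes _ = cong suc (length-filter-∁ P? xs)
... | no _ = trans (+-suc _ _) (cong suc (length-filter-∁ P? xs))

length-concatMap-≤ : ∀ (f : A → List B) {r} xs → (∀ {x} → x ∈ xs → length (f x) ≤ r) →
  length (concatMap f xs) ≤ length xs * r
length-concatMap-≤ f [] _ = z≤n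
length-concatMap-≤ f (x ∷ xs) le =
  ≤-trans (≤-reflexive (length-++ (f x)))
          (+-mono-≤ (le (here refl)) (length-concatMap-≤ f xs (le ∘ there)))

∑ : List A → (A → ℕ) → ℕ
∑ xs f = sum (map f xs)

∑-cong : ∀ {f g : A → ℕ} xs → (∀ x → f x ≡ g x) → ∑ xs f ≡ ∑ xs g
∑-cong [] _ = refl
∑-cong (x ∷ xs) e = cong₂ _+_ (e x) (∑-cong xs e)

∑-mono : ∀ {f g : A → ℕ} xs → (∀ x → f x ≤ g x) → ∑ xs f ≤ ∑ xs g
∑-mono [] _ = z≤n
∑-mono (x ∷ xs) le = +-mono-≤ (le x) (∑-mono xs le)

∑-+ : ∀ (f g : A → ℕ) xs → ∑ xs (λ x → f x + g x) ≡ ∑ xs f + ∑ xs g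
∑-+ f g [] = refl
∑-+ f g (x ∷ xs) = trans (cong (f x + g x +_) (∑-+ f g xs))
  (+-exchange (f x) (g x) (∑ xs f) (∑ xs g))
  where
  open import Algebra.Properties.CommutativeSemigroup +-commutativeSemigroup
    renaming (interchange to +-exchange)

∑-* : ∀ c (f : A → ℕ) xs → ∑ xs (λ x → c * f x) ≡ c * ∑ xs f
∑-* c f [] = sym (*-zeroʳ c)
∑-* c f (x ∷ xs) = trans (cong (c * f x +_) (∑-* c f xs)) (sym (*-distribˡ-+ c (f x) _))

∑-zero : ∀ (xs : List A) → ∑ xs (λ _ → 0) ≡ 0
∑-zero [] = refl
∑-zero (x ∷ xs) = ∑-zero xs

∑-one : ∀ (xs : List A) → ∑ xs (λ _ → 1) ≡ length xs
∑-one [] = refl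
∑-one (x ∷ xs) = cong suc (∑-one xs)

∑-swap : ∀ (f : A → B → ℕ) xs ys →
  ∑ xs (λ x → ∑ ys (f x)) ≡ ∑ ys (λ y → ∑ xs (λ x → f x y))
∑-swap f [] ys = sym (∑-zero ys)
∑-swap f (x ∷ xs) ys = trans (cong (∑ ys (f x) +_) (∑-swap f xs ys))
  (sym (∑-+ (f x) (λ y → ∑ xs (λ x → f x y)) ys))

∑-≤-length : ∀ (f : A → ℕ) {c} xs → (∀ {x} → x ∈ xs → f x ≤ c) → ∑ xs f ≤ length xs * c
∑-≤-length f [] _ = z≤n
∑-≤-length f (x ∷ xs) le = +-mono-≤ (le (here refl)) (∑-≤-length f xs (le ∘ there))

∑-++ : ∀ (f : A → ℕ) xs ys → ∑ (xs ++ ys) f ≡ ∑ xs f + ∑ ys f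
∑-++ f [] ys = refl
∑-++ f (x ∷ xs) ys = trans (cong (f x +_) (∑-++ f xs ys)) (sym (+-assoc (f x) _ _))

∑-map : ∀ (f : B → ℕ) (g : A → B) xs → ∑ (map g xs) f ≡ ∑ xs (f ∘ g)
∑-map f g [] = refl
∑-map f g (x ∷ xs) = cong (f (g x) +_) (∑-map f g xs)

∑-member-≤ : ∀ (f : A → ℕ) {x} xs → x ∈ xs → f x ≤ ∑ xs f
∑-member-≤ f (x ∷ xs) (here refl) = m≤m+n _ _
∑-member-≤ f (x ∷ xs) (there p) = ≤-trans (∑-member-≤ f xs p) (m≤n+m _ _)

-- The first-moment method: if the failures, summed over all outcomes, are fewer than the outcomes,
-- some outcome has no failure.
∑<length⇒∃zero : ∀ (f : A → ℕ) xs → ∑ xs f < length xs → ∃ λ x → f x ≡ 0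
∑<length⇒∃zero f (x ∷ xs) lt with f x in e
... | zero = x , e
... | suc k = ∑<length⇒∃zero f xs (≤-trans (s≤s (m≤n+m _ k)) (s≤s⁻¹ lt))

length-cartesianProductWith : ∀ {C : Set} (f : A → B → C) xs ys →
  length (cartesianProductWith f xs ys) ≡ length xs * length ys
length-cartesianProductWith f [] ys = refl
length-cartesianProductWith f (x ∷ xs) ys = trans (length-++ (map (f x) ys))
  (cong₂ _+_ (length-map (f x) ys) (length-cartesianProductWith f xs ys))

-- Powers and Bernoulli's inequality

^-distribʳ-* : ∀ o m n → (m * n) ^ o ≡ m ^ o * n ^ o
^-distribʳ-* zero m n = refl
^-distribʳ-* (suc o) m n = trans (cong (m * n *_) (^-distribʳ-* o m n)) ([m*n]*[o*p]≡[m*o]*[n*p] m n (m ^ o) (n ^ o))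

n<2^n : ∀ n → n < 2 ^ n
n<2^n zero = s≤s z≤n
n<2^n (suc n) = ≤-trans (+-mono-≤ (m^n>0 2 n) (n<2^n n))
  (≤-reflexive (cong (2 ^ n +_) (sym (+-identityʳ _))))

-- Bernoulli: ((a + w) / a) ^ j ≥ 1 + j w / a.
bernoulli : ∀ a w j → a ^ j * (a + j * w) ≤ a * (a + w) ^ j
bernoulli a w zero = ≤-reflexive (lemma a)
  where
  lemma : ∀ a → 1 * (a + 0) ≡ a * 1
  lemma = solve-∀
bernoulli a w (suc j) = begin
  a * a ^ j * (a + suc j * w)                       ≤⟨ m≤m+n _ _ ⟩
  -- The added term is the quadratic part of (a + j w)(a + w), which Bernoulli discards.
  a * a ^ j * (a + suc j * w) + a ^ j * (j * w * w) ≡⟨ lemma a (a ^ j) j w ⟩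
  a ^ j * (a + j * w) * (a + w)                     ≤⟨ *-monoˡ-≤ (a + w) (bernoulli a w j) ⟩
  a * (a + w) ^ j * (a + w)                         ≡⟨ *-assoc a _ _ ⟩
  a * ((a + w) ^ j * (a + w))                       ≡⟨ cong (a *_) (*-comm ((a + w) ^ j) (a + w)) ⟩
  a * (a + w) ^ suc j                               ∎
  where
  open ≤-Reasoning
  lemma : ∀ a p j w → a * p * (a + suc j * w) + p * (j * w * w) ≡ p * (a + j * w) * (a + w)
  lemma = solve-∀

2*a^j≤[a+w]^j : ∀ {a w j} .{{_ : NonZero a}} → a ≤ j * w → 2 * a ^ j ≤ (a + w) ^ j
2*a^j≤[a+w]^j {a} {w} {j} a≤jw = *-cancelˡ-≤ a (begin
  a * (2 * a ^ j)     ≡⟨ lemma a (a ^ j) ⟩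
  a ^ j * (a + a)     ≤⟨ *-monoʳ-≤ (a ^ j) (+-monoʳ-≤ a a≤jw) ⟩
  a ^ j * (a + j * w) ≤⟨ bernoulli a w j ⟩
  a * (a + w) ^ j     ∎)
  where
  open ≤-Reasoning
  lemma : ∀ a p → a * (2 * p) ≡ p * (a + a)
  lemma = solve-∀

-- The ℓ factors contain c blocks of j; each block doubles by Bernoulli, and the leftover factors do
-- no harm.
2^c*a^ℓ≤[a+w]^ℓ : ∀ {a w j} c ℓ .{{_ : NonZero a}} → a ≤ j * w → j * c ≤ ℓ →
  2 ^ c * a ^ ℓ ≤ (a + w) ^ ℓ
2^c*a^ℓ≤[a+w]^ℓ {a} {w} {j} c ℓ a≤jw jc≤ℓ with m≤n⇒∃[o]m+o≡n jc≤ℓ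
... | o , refl = begin
  2 ^ c * a ^ (j * c + o)       ≡⟨ cong (2 ^ c *_) (^-distribˡ-+-* a (j * c) o) ⟩
  2 ^ c * (a ^ (j * c) * a ^ o) ≡⟨ cong (λ z → 2 ^ c * (z * a ^ o)) (sym (^-*-assoc a j c)) ⟩
  2 ^ c * ((a ^ j) ^ c * a ^ o) ≡⟨ sym (*-assoc (2 ^ c) _ _) ⟩
  2 ^ c * (a ^ j) ^ c * a ^ o   ≡⟨ cong (_* a ^ o) (sym (^-distribʳ-* c 2 (a ^ j))) ⟩
  (2 * a ^ j) ^ c * a ^ o       ≤⟨ *-mono-≤ (^-monoˡ-≤ c (2*a^j≤[a+w]^j {a} {w} {j} a≤jw)) (^-monoˡ-≤ o (m≤m+n a w)) ⟩
  ((a + w) ^ j) ^ c * (a + w) ^ o ≡⟨ cong (_* (a + w) ^ o) (^-*-assoc (a + w) j c) ⟩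
  (a + w) ^ (j * c) * (a + w) ^ o ≡⟨ sym (^-distribˡ-+-* (a + w) (j * c) o) ⟩
  (a + w) ^ (j * c + o)         ∎
  where open ≤-Reasoning

-- Random tournaments

allBits : ∀ N → List (Vec Bool N)
allBits zero = [] ∷ []
allBits (suc N) = map (true ∷_) (allBits N) ++ map (false ∷_) (allBits N)

length-allBits : ∀ N → length (allBits N) ≡ 2 ^ N
length-allBits zero = refl
length-allBits (suc N) = begin
  length (allBits (suc N))
    ≡⟨ length-++ (map (true ∷_) (allBits N)) ⟩
  length (map (true ∷_) (allBits N)) + length (map (false ∷_) (allBits N))
    ≡⟨ cong₂ _+_ (length-map (true ∷_) (allBits N)) (length-map (false ∷_) (allBits N)) ⟩
  length (allBits N) + length (allBits N)
    ≡⟨ cong (λ x → x + x) (length-allBits N) ⟩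
  2 ^ N + 2 ^ N
    ≡⟨ cong (2 ^ N +_) (sym (+-identityʳ (2 ^ N))) ⟩
  2 ^ suc N ∎
  where open ≡-Reasoning

∑-bits-suc : ∀ {N} (f : Vec Bool (suc N) → ℕ) →
  ∑ (allBits (suc N)) f ≡ ∑ (allBits N) (f ∘ (true ∷_)) + ∑ (allBits N) (f ∘ (false ∷_))
∑-bits-suc {N} f = trans (∑-++ f (map (true ∷_) (allBits N)) _)
  (cong₂ _+_ (∑-map f (true ∷_) (allBits N)) (∑-map f (false ∷_) (allBits N)))

-- Negating one coordinate permutes the assignments; at coordinate 0 it exchanges the two halves of
-- `allBits`.
∑-bits-flip : ∀ {N} (i : Fin N) (f : Vec Bool N → ℕ) →
  ∑ (allBits N) (λ b → f (updateAt b i not)) ≡ ∑ (allBits N) f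
∑-bits-flip {suc N} Fin.zero f = trans (∑-bits-suc (λ b → f (updateAt b Fin.zero not)))
  (trans (+-comm (∑ (allBits N) (f ∘ (false ∷_))) _) (sym (∑-bits-suc f)))
∑-bits-flip {suc N} (Fin.suc i) f = trans (∑-bits-suc (λ b → f (updateAt b (Fin.suc i) not)))
  (trans (cong₂ _+_ (∑-bits-flip i (f ∘ (true ∷_))) (∑-bits-flip i (f ∘ (false ∷_))))
    (sym (∑-bits-suc f)))

𝟙 : Bool → ℕ
𝟙 true = 1
𝟙 false = 0

-- (x , true) asks for an arc towards x, (x , false) for an arc from x.
agrees : ∀ {m} → OGraph m → Fin m → Fin m × Bool → Bool
agrees H v (x , true) = arc H v x
agrees H v (x , false) = arc H x v

agreesAll : ∀ {m} → OGraph m → List (Fin m × Bool) → Fin m → Bool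
agreesAll H X v = all (agrees H v) X

agreeing : ∀ {m} → OGraph m → List (Fin m × Bool) → List (Fin m)
agreeing {m} H X = filterᵇ (agreesAll H X) (allFin m)

agreesAll-∈ : ∀ {m} (H : OGraph m) X {v y} → T (agreesAll H X v) → y ∈ X → agrees H v y ≡ true
agreesAll-∈ H (y ∷ X) {v} t (here refl) with agrees H v y
... | true = refl
agreesAll-∈ H (x ∷ X) {v} t (there y∈) with agrees H v x
... | true = agreesAll-∈ H X t y∈

module Random (m : ℕ) where

  Bits : Set
  Bits = Vec Bool (m * m)

  bit : Bits → Fin m → Fin m → Bool
  bit b u v = lookup b (combine u v)

  -- The sum of the two bits at a pair is symmetric; adding this antisymmetric bit makes it an
  -- orientation.
  _precedes_ : Fin m → Fin m → Bool
  u precedes v = does (u Fin.<? v)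

  -- Giving each ordered pair its own bit and adding the two makes the arc
  -- at {u , v} sensitive to flipping the bit of (u , v), whatever their order.
  arcᵇ : Bits → Fin m → Fin m → Bool
  arcᵇ b u v with u ≟ v
  ... | yes _ = false
  ... | no _ = (bit b u v xor bit b v u) xor (u precedes v)

  precedes-asym : ∀ {u v} → u ≢ v → (v precedes u) ≡ not (u precedes v)
  precedes-asym {u} {v} u≢v with Fin.<-cmp u v
  ... | tri< a _ c = trans (dec-false (v Fin.<? u) c) (cong not (sym (dec-true (u Fin.<? v) a)))
  ... | tri≈ _ e _ = contradiction e u≢v
  ... | tri> a _ c = trans (dec-true (v Fin.<? u) c) (cong not (sym (dec-false (u Fin.<? v) a)))

  arcᵇ-asym : ∀ b {u v} → u ≢ v → arcᵇ b v u ≡ not (arcᵇ b u v)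
  arcᵇ-asym b {u} {v} u≢v with u ≟ v | v ≟ u
  ... | yes e | _ = contradiction e u≢v
  ... | no _ | yes e = contradiction (sym e) u≢v
  ... | no _ | no _ rewrite precedes-asym u≢v = lemma (bit b u v) (bit b v u) (u precedes v)
    where
    lemma : ∀ p q r → (q xor p) xor not r ≡ not ((p xor q) xor r)
    lemma true true true = refl
    lemma true true false = refl
    lemma true false true = refl
    lemma true false false = refl
    lemma false true true = refl
    lemma false true false = refl
    lemma false false true = refl
    lemma false false false = refl

  arcᵇ-irrefl : ∀ b u → arcᵇ b u u ≡ false
  arcᵇ-irrefl b u with u ≟ u
  ... | yes _ = refl
  ... | no u≢u = contradiction refl u≢u

  tournament : Bits → OGraph m
  tournament b = record { arc = arcᵇ b ; noLoop = arcᵇ-irrefl b ; noOpp = opp }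
    where
    opp : ∀ u v → arcᵇ b u v ≡ true → arcᵇ b v u ≡ false
    opp u v a with u ≟ v
    ... | yes refl = arcᵇ-irrefl b u
    ... | no u≢v = trans (arcᵇ-asym b u≢v) (cong not (trans (arcᵇ-no u≢v) a))
      where
      arcᵇ-no : u ≢ v → arcᵇ b u v ≡ (bit b u v xor bit b v u) xor (u precedes v)
      arcᵇ-no ne with u ≟ v
      ... | yes e = contradiction e ne
      ... | no _ = refl

  flip : Fin m → Fin m → Bits → Bits
  flip v x b = updateAt b (combine v x) not

  bit-flip-≢ : ∀ b {v x v′ x′} → ¬ (v′ ≡ v × x′ ≡ x) → bit (flip v x b) v′ x′ ≡ bit b v′ x′
  bit-flip-≢ b {v} {x} {v′} {x′} ne =
    lookup∘updateAt′ (combine v′ x′) (combine v x) (ne ∘ combine-injective v′ x′ v x) b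

  arcᵇ-flip : ∀ b {v x} → v ≢ x → arcᵇ (flip v x b) v x ≡ not (arcᵇ b v x)
  arcᵇ-flip b {v} {x} v≢x with v ≟ x
  ... | yes e = contradiction e v≢x
  ... | no _ rewrite lookup∘updateAt (combine v x) {not} b
                   | bit-flip-≢ b {v} {x} {x} {v} (λ (e , _) → v≢x (sym e)) =
    lemma (bit b v x) (bit b x v) (v precedes x)
    where
    lemma : ∀ p q r → (not p xor q) xor r ≡ not ((p xor q) xor r)
    lemma true true true = refl
    lemma true true false = refl
    lemma true false true = refl
    lemma true false false = refl
    lemma false true true = refl
    lemma false true false = refl
    lemma false false true = refl
    lemma false false false = refl

  arcᵇ-flip-≢ : ∀ b {v x v′ x′} → ¬ (v′ ≡ v × x′ ≡ x) → ¬ (x′ ≡ v × v′ ≡ x) →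
    arcᵇ (flip v x b) v′ x′ ≡ arcᵇ b v′ x′
  arcᵇ-flip-≢ b {v} {x} {v′} {x′} ne ne′ with v′ ≟ x′
  ... | yes _ = refl
  ... | no _ rewrite bit-flip-≢ b ne | bit-flip-≢ b ne′ = refl

  agreesᵇ : Bits → Fin m → Fin m × Bool → Bool
  agreesᵇ b = agrees (tournament b)

  agreesAllᵇ : Bits → List (Fin m × Bool) → Fin m → Bool
  agreesAllᵇ b = agreesAll (tournament b)

  agrees-flip : ∀ b {v x} s → v ≢ x → agreesᵇ (flip v x b) v (x , s) ≡ not (agreesᵇ b v (x , s))
  agrees-flip b true v≢x = arcᵇ-flip b v≢x
  agrees-flip b {v} {x} false v≢x = begin
    arcᵇ (flip v x b) x v       ≡⟨ arcᵇ-asym (flip v x b) v≢x ⟩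
    not (arcᵇ (flip v x b) v x) ≡⟨ cong not (arcᵇ-flip b v≢x) ⟩
    not (not (arcᵇ b v x))      ≡⟨ cong not (sym (arcᵇ-asym b v≢x)) ⟩
    not (arcᵇ b x v)            ∎
    where open ≡-Reasoning

  agrees-flip-≢ : ∀ b {v x v′ x′} s → ¬ (v′ ≡ v × x′ ≡ x) → ¬ (x′ ≡ v × v′ ≡ x) →
    agreesᵇ (flip v x b) v′ (x′ , s) ≡ agreesᵇ b v′ (x′ , s)
  agrees-flip-≢ b true ne ne′ = arcᵇ-flip-≢ b ne ne′
  agrees-flip-≢ b false ne ne′ = arcᵇ-flip-≢ b ne′ ne

  -- The flip affects only the arc between v and x. Matching X at v′ reads it either when v′ is v
  -- and x is in X, or when v′ is x and v is in X; both are excluded.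
  agreesAll-flip-≢ : ∀ b {v x v′} X → v ∉ map proj₁ X → ¬ (v′ ≡ v × x ∈ map proj₁ X) →
    agreesAllᵇ (flip v x b) X v′ ≡ agreesAllᵇ b X v′
  agreesAll-flip-≢ b [] _ _ = refl
  agreesAll-flip-≢ b ((y , s) ∷ X) v∉ ne = cong₂ _∧_
    (agrees-flip-≢ b s (λ { (e , refl) → ne (e , here refl) }) (λ { (refl , _) → v∉ (here refl) }))
    (agreesAll-flip-≢ b X (v∉ ∘ there) (λ (e , p) → ne (e , there p)))

  -- Expectation times 2 ^ (m * m), so that all identities stay among natural numbers.
  𝔼 : (Bits → ℕ) → ℕ
  𝔼 = ∑ (allBits (m * m))

  -- Stands in for the independence of `Q` from the arcs between v and X.
  FlipInvariant : Fin m → List (Fin m × Bool) → (Bits → ℕ) → Set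
  FlipInvariant v X Q = ∀ {x} → x ∈ map proj₁ X → ∀ b → Q (flip v x b) ≡ Q b

  -- Flipping the bit of (v , x) exchanges the agreeing and the disagreeing assignments.
  𝔼-agrees : ∀ {v x} s (Q : Bits → ℕ) → v ≢ x → (∀ b → Q (flip v x b) ≡ Q b) →
    2 * 𝔼 (λ b → 𝟙 (agreesᵇ b v (x , s)) * Q b) ≡ 𝔼 Q
  𝔼-agrees {v} {x} s Q v≢x inv = begin
    2 * 𝔼 f                ≡⟨ cong (𝔼 f +_) (+-identityʳ (𝔼 f)) ⟩
    𝔼 f + 𝔼 f              ≡⟨ cong (𝔼 f +_) (sym (∑-bits-flip (combine v x) f)) ⟩
    𝔼 f + 𝔼 (f ∘ flip v x) ≡⟨ sym (∑-+ f (f ∘ flip v x) (allBits (m * m))) ⟩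
    𝔼 (λ b → f b + f (flip v x b)) ≡⟨ ∑-cong (allBits (m * m)) pointwise ⟩
    𝔼 Q ∎
    where
    open ≡-Reasoning
    f : Bits → ℕ
    f b = 𝟙 (agreesᵇ b v (x , s)) * Q b
    pointwise : ∀ b → f b + f (flip v x b) ≡ Q b
    pointwise b rewrite agrees-flip b s v≢x | inv b with agreesᵇ b v (x , s)
    ... | true = trans (+-identityʳ _) (+-identityʳ _)
    ... | false = +-identityʳ _

  -- Each element of X contributes a factor 1/2 by `𝔼-agrees`, the indicator for the rest of X being
  -- absorbed into `Q`; distinctness of the vertices in X keeps that product invariant.
  𝔼-agreesAll : ∀ {v} X (Q : Bits → ℕ) → Unique (map proj₁ X) → v ∉ map proj₁ X →
    FlipInvariant v X Q → 2 ^ length X * 𝔼 (λ b → 𝟙 (agreesAllᵇ b X v) * Q b) ≡ 𝔼 Q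
  𝔼-agreesAll [] Q _ _ _ = trans (+-identityʳ _) (∑-cong (allBits (m * m)) λ b → +-identityʳ (Q b))
  𝔼-agreesAll {v} ((x , s) ∷ X) Q (x∉ ∷ uniq) v∉ inv = begin
    2 * 2 ^ length X * 𝔼 (λ b → 𝟙 (agreesAllᵇ b ((x , s) ∷ X) v) * Q b)
      ≡⟨ cong (2 * 2 ^ length X *_) (∑-cong (allBits (m * m)) split) ⟩
    2 * 2 ^ length X * 𝔼 (λ b → 𝟙 (agreesᵇ b v (x , s)) * Q′ b)
      ≡⟨ rearrange (2 ^ length X) _ ⟩
    2 ^ length X * (2 * 𝔼 (λ b → 𝟙 (agreesᵇ b v (x , s)) * Q′ b))
      ≡⟨ cong (2 ^ length X *_) (𝔼-agrees s Q′ (v∉ ∘ here) Q′-inv) ⟩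
    2 ^ length X * 𝔼 Q′
      ≡⟨ 𝔼-agreesAll X Q uniq (v∉ ∘ there) (inv ∘ there) ⟩
    𝔼 Q ∎
    where
    open ≡-Reasoning
    Q′ : Bits → ℕ
    Q′ b = 𝟙 (agreesAllᵇ b X v) * Q b
    rearrange : ∀ p e → 2 * p * e ≡ p * (2 * e)
    rearrange = solve-∀
    𝟙-∧ : ∀ p q c → 𝟙 (p ∧ q) * c ≡ 𝟙 p * (𝟙 q * c)
    𝟙-∧ true q c = sym (+-identityʳ _)
    𝟙-∧ false q c = refl
    split : ∀ b → 𝟙 (agreesAllᵇ b ((x , s) ∷ X) v) * Q b ≡ 𝟙 (agreesᵇ b v (x , s)) * Q′ b
    split b = 𝟙-∧ (agreesᵇ b v (x , s)) (agreesAllᵇ b X v) (Q b)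
    Q′-inv : ∀ b → Q′ (flip v x b) ≡ Q′ b
    Q′-inv b = cong₂ (λ p q → 𝟙 p * q)
      (agreesAll-flip-≢ b X (v∉ ∘ there) (λ (_ , x∈) → All.lookup x∉ x∈ refl)) (inv (here refl) b)

  -- An exponential moment as in Chernoff bounds: every vertex that fails to match multiplies the
  -- weight by 9, so few matches force a large product.
  weight : Bool → ℕ
  weight true = 1
  weight false = 9

  weights : List (Fin m × Bool) → List (Fin m) → Bits → ℕ
  weights X L b = product (map (λ v → weight (agreesAllᵇ b X v)) L)

  weights-flip : ∀ {v x} X L b → v ∉ L → v ∉ map proj₁ X → weights X L (flip v x b) ≡ weights X L b
  weights-flip X [] b _ _ = refl
  weights-flip X (u ∷ L) b v∉L v∉X = cong₂ (λ p q → weight p * q)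
    (agreesAll-flip-≢ b X v∉X (λ (e , _) → v∉L (here (sym e))))
    (weights-flip X L b (v∉L ∘ there) v∉X)

  -- With c = 2 ^ `length X`, one vertex has mean weight (1 + 9 (c - 1)) / c = a / c. Vertices
  -- outside X use different arcs to X, so the means multiply.
  𝔼-weights : ∀ {a} X L → a + 8 ≡ 9 * 2 ^ length X → Unique (map proj₁ X) → Unique L →
    (∀ {v} → v ∈ L → v ∉ map proj₁ X) →
    (2 ^ length X) ^ length L * 𝔼 (weights X L) ≡ a ^ length L * 2 ^ (m * m)
  𝔼-weights X [] _ _ _ _ = cong (_+ 0)
    (trans (∑-one (allBits (m * m))) (length-allBits (m * m)))
  𝔼-weights {a} X (v ∷ L) a+8 uniqX (v∉L ∷ uniqL) disj = begin
    c * c ^ length L * 𝔼 (weights X (v ∷ L))  ≡⟨ swap c _ _ ⟩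
    c ^ length L * (c * 𝔼 (weights X (v ∷ L))) ≡⟨ cong (c ^ length L *_) one ⟩
    c ^ length L * (a * 𝔼 Q) ≡⟨ swap′ (c ^ length L) a (𝔼 Q) ⟩
    a * (c ^ length L * 𝔼 Q) ≡⟨ cong (a *_) (𝔼-weights X L a+8 uniqX uniqL (disj ∘ there)) ⟩
    a * (a ^ length L * 2 ^ (m * m)) ≡⟨ sym (*-assoc a _ _) ⟩
    a * a ^ length L * 2 ^ (m * m) ∎
    where
    open ≡-Reasoning
    c = 2 ^ length X
    Q : Bits → ℕ
    Q = weights X L
    agr : Bits → Bool
    agr b = agreesAllᵇ b X v
    swap : ∀ p q e → p * q * e ≡ q * (p * e)
    swap = solve-∀
    swap′ : ∀ p q e → p * (q * e) ≡ q * (p * e)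
    swap′ = solve-∀
    Q-inv : FlipInvariant v X Q
    Q-inv _ b = weights-flip X L b (λ v∈ → All.lookup v∉L v∈ refl) (disj (here refl))
    half : c * 𝔼 (λ b → 𝟙 (agr b) * Q b) ≡ 𝔼 Q
    half = 𝔼-agreesAll X Q uniqX (disj (here refl)) Q-inv
    -- The weight is 9 minus 8 times the indicator, stated without subtraction.
    pointwise : ∀ p q → weight p * q + 8 * (𝟙 p * q) ≡ 9 * q
    pointwise true = solve-∀
    pointwise false = solve-∀
    total : 𝔼 (weights X (v ∷ L)) + 8 * 𝔼 (λ b → 𝟙 (agr b) * Q b) ≡ 9 * 𝔼 Q
    total = begin
      𝔼 (weights X (v ∷ L)) + 8 * 𝔼 (λ b → 𝟙 (agr b) * Q b)
        ≡⟨ cong (𝔼 (weights X (v ∷ L)) +_) (sym (∑-* 8 (λ b → 𝟙 (agr b) * Q b) (allBits (m * m)))) ⟩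
      𝔼 (weights X (v ∷ L)) + 𝔼 (λ b → 8 * (𝟙 (agr b) * Q b))
        ≡⟨ sym (∑-+ (weights X (v ∷ L)) (λ b → 8 * (𝟙 (agr b) * Q b)) (allBits (m * m))) ⟩
      𝔼 (λ b → weights X (v ∷ L) b + 8 * (𝟙 (agr b) * Q b))
        ≡⟨ ∑-cong (allBits (m * m)) (λ b → pointwise (agr b) (Q b)) ⟩
      𝔼 (λ b → 9 * Q b)
        ≡⟨ ∑-* 9 Q (allBits (m * m)) ⟩
      9 * 𝔼 Q ∎
    one : c * 𝔼 (weights X (v ∷ L)) ≡ a * 𝔼 Q
    one = +-cancelʳ-≡ (8 * 𝔼 Q) _ _ (begin
      c * 𝔼 (weights X (v ∷ L)) + 8 * 𝔼 Q
        ≡⟨ cong (λ z → c * 𝔼 (weights X (v ∷ L)) + 8 * z) (sym half) ⟩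
      c * 𝔼 (weights X (v ∷ L)) + 8 * (c * 𝔼 (λ b → 𝟙 (agr b) * Q b))
        ≡⟨ factor c _ _ ⟩
      c * (𝔼 (weights X (v ∷ L)) + 8 * 𝔼 (λ b → 𝟙 (agr b) * Q b))
        ≡⟨ cong (c *_) total ⟩
      c * (9 * 𝔼 Q) ≡⟨ shuffle c _ ⟩
      (9 * c) * 𝔼 Q ≡⟨ cong (_* 𝔼 Q) (sym a+8) ⟩
      (a + 8) * 𝔼 Q ≡⟨ *-distribʳ-+ (𝔼 Q) a 8 ⟩
      a * 𝔼 Q + 8 * 𝔼 Q ∎)
      where
      factor : ∀ c p q → c * p + 8 * (c * q) ≡ c * (p + 8 * q)
      factor = solve-∀
      shuffle : ∀ c q → c * (9 * q) ≡ (9 * c) * q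
      shuffle = solve-∀

  weights-agreeing : ∀ X L b →
    weights X L b * 9 ^ length (filterᵇ (agreesAllᵇ b X) L) ≡ 9 ^ length L
  weights-agreeing X [] b = refl
  weights-agreeing X (v ∷ L) b with agreesAllᵇ b X v
  ... | true = trans (shuffle (weights X L b) _) (cong (9 *_) (weights-agreeing X L b))
    where
    shuffle : ∀ w p → (w + 0) * (9 * p) ≡ 9 * (w * p)
    shuffle = solve-∀
  ... | false = trans (*-assoc 9 (weights X L b) _) (cong (9 *_) (weights-agreeing X L b))

  few : ℕ → List (Fin m × Bool) → Bits → ℕ
  few k X b = 𝟙 (length (agreeing (tournament b) X) <ᵇ k)

  few≡0⇒≤ : ∀ k X b → few k X b ≡ 0 → k ≤ length (agreeing (tournament b) X)
  few≡0⇒≤ k X b e with length (agreeing (tournament b) X) <ᵇ k in eq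
  ... | false = ≮⇒≥ (λ lt → subst T eq (<⇒<ᵇ lt))

  open import Data.List.Membership.DecPropositional (_≟_ {m}) using (_∈?_)

  outside : List (Fin m × Bool) → List (Fin m)
  outside X = filter (¬? ∘ (_∈? map proj₁ X)) (allFin m)

  length-outside : ∀ X → m ≤ length X + length (outside X)
  length-outside X = begin
    m                                   ≡⟨ sym (length-tabulate id) ⟩
    length (allFin m)                   ≡⟨ sym (length-filter-∁ (_∈? map proj₁ X) (allFin m)) ⟩
    length inside + length (outside X)  ≤⟨ +-monoˡ-≤ _ (≤-trans inside≤ (≤-reflexive (length-map proj₁ X))) ⟩
    length X + length (outside X)       ∎
    where
    open ≤-Reasoning
    inside : List (Fin m)
    inside = filter (_∈? map proj₁ X) (allFin m)
    inside≤ : length inside ≤ length (map proj₁ X)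
    inside≤ = length-≤-⊆ (Unique.filter⁺ (_∈? map proj₁ X) (Unique.allFin⁺ m))
      (λ x∈ → proj₂ (∈-filter⁻ (_∈? map proj₁ X) {xs = allFin m} x∈))

  -- The pointwise form of Markov's inequality: with at most r matches, at least ℓ - r of the ℓ
  -- outside vertices contribute 9.
  few≤weights : ∀ r X b → 9 ^ length (outside X) * few (suc r) X b ≤ 9 ^ r * weights X (outside X) b
  few≤weights r X b with length (agreeing (tournament b) X) <ᵇ suc r in eq
  ... | false = ≤-trans (≤-reflexive (*-zeroʳ (9 ^ length (outside X)))) z≤n
  ... | true = begin
    9 ^ length L * 1                    ≡⟨ *-identityʳ _ ⟩
    9 ^ length L                        ≡⟨ sym (weights-agreeing X L b) ⟩
    weights X L b * 9 ^ length (filterᵇ (agreesAllᵇ b X) L)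
      ≤⟨ *-monoʳ-≤ (weights X L b) (^-monoʳ-≤ 9 (≤-trans filtered≤ count≤r)) ⟩
    weights X L b * 9 ^ r               ≡⟨ *-comm (weights X L b) _ ⟩
    9 ^ r * weights X L b               ∎
    where
    open ≤-Reasoning
    L = outside X
    count≤r : length (agreeing (tournament b) X) ≤ r
    count≤r = s≤s⁻¹ (<ᵇ⇒< _ _ (subst T (sym eq) _))
    agr? = T? ∘ agreesAllᵇ b X
    filtered≤ : length (filter agr? L) ≤ length (agreeing (tournament b) X)
    filtered≤ = length-≤-⊆
      (Unique.filter⁺ agr? (Unique.filter⁺ (¬? ∘ (_∈? map proj₁ X)) (Unique.allFin⁺ m)))
      (λ v∈ → ∈-filter⁺ agr? (∈-allFin _) (proj₂ (∈-filter⁻ agr? {xs = L} v∈)))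

  -- Markov's inequality bounds the probability of `few` by 9^r (a / (a + 8))^ℓ, and `gain` turns
  -- this into 9^r / 2^c. Multiplying through by a^ℓ avoids fractions.
  𝔼-few : ∀ {a c r} X .{{_ : NonZero a}} → a + 8 ≡ 9 * 2 ^ length X →
    (∀ ℓ → m ≤ length X + ℓ → 2 ^ c * a ^ ℓ ≤ (a + 8) ^ ℓ) →
    Unique (map proj₁ X) → 2 ^ c * 𝔼 (few (suc r) X) ≤ 9 ^ r * 2 ^ (m * m)
  𝔼-few {a} {c} {r} X a+8 gain uniq = *-cancelˡ-≤ (a ^ ℓ) {{m^n≢0 a ℓ}} (begin
    a ^ ℓ * (2 ^ c * e)               ≡⟨ shuffle₁ (a ^ ℓ) (2 ^ c) e ⟩
    2 ^ c * a ^ ℓ * e                 ≤⟨ *-monoˡ-≤ e (gain ℓ (length-outside X)) ⟩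
    (a + 8) ^ ℓ * e                   ≡⟨ cong (λ z → z ^ ℓ * e) a+8 ⟩
    (9 * p) ^ ℓ * e                   ≡⟨ cong (_* e) (^-distribʳ-* ℓ 9 p) ⟩
    9 ^ ℓ * p ^ ℓ * e                 ≡⟨ shuffle₂ (9 ^ ℓ) (p ^ ℓ) e ⟩
    p ^ ℓ * (9 ^ ℓ * e)               ≡⟨ cong (p ^ ℓ *_) (sym (∑-* (9 ^ ℓ) (few (suc r) X) Ω)) ⟩
    p ^ ℓ * 𝔼 (λ b → 9 ^ ℓ * few (suc r) X b)
      ≤⟨ *-monoʳ-≤ (p ^ ℓ) (∑-mono Ω (few≤weights r X)) ⟩
    p ^ ℓ * 𝔼 (λ b → 9 ^ r * w b)     ≡⟨ cong (p ^ ℓ *_) (∑-* (9 ^ r) w Ω) ⟩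
    p ^ ℓ * (9 ^ r * 𝔼 w)             ≡⟨ shuffle₃ (p ^ ℓ) (9 ^ r) (𝔼 w) ⟩
    9 ^ r * (p ^ ℓ * 𝔼 w)             ≡⟨ cong (9 ^ r *_) (𝔼-weights X (outside X) a+8 uniq uniqL disj) ⟩
    9 ^ r * (a ^ ℓ * 2 ^ (m * m))     ≡⟨ shuffle₃ (9 ^ r) (a ^ ℓ) _ ⟩
    a ^ ℓ * (9 ^ r * 2 ^ (m * m))     ∎)
    where
    open ≤-Reasoning
    Ω = allBits (m * m)
    ℓ = length (outside X)
    p = 2 ^ length X
    e = 𝔼 (few (suc r) X)
    w = weights X (outside X)
    uniqL : Unique (outside X)
    uniqL = Unique.filter⁺ (¬? ∘ (_∈? map proj₁ X)) (Unique.allFin⁺ m)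
    disj : ∀ {v} → v ∈ outside X → v ∉ map proj₁ X
    disj v∈ = proj₂ (∈-filter⁻ (¬? ∘ (_∈? map proj₁ X)) {xs = allFin m} v∈)
    shuffle₁ : ∀ x y z → x * (y * z) ≡ y * x * z
    shuffle₁ = solve-∀
    shuffle₂ : ∀ x y z → x * y * z ≡ y * (x * z)
    shuffle₂ = solve-∀
    shuffle₃ : ∀ x y z → x * (y * z) ≡ y * (x * z)
    shuffle₃ = solve-∀

  signed : List (Fin m × Bool)
  signed = cartesianProduct (allFin m) (true ∷ false ∷ [])

  ∈-signed : ∀ y → y ∈ signed
  ∈-signed (x , true) = ∈-cartesianProduct⁺ (∈-allFin x) (here refl)
  ∈-signed (x , false) = ∈-cartesianProduct⁺ (∈-allFin x) (there (here refl))

  -- Ordered lists in place of sets: the union bound can afford (2m)^k events.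
  signedSets : ℕ → List (List (Fin m × Bool))
  signedSets zero = [] ∷ []
  signedSets (suc k) = cartesianProductWith _∷_ signed (signedSets k)

  ∈-signedSets : ∀ X → X ∈ signedSets (length X)
  ∈-signedSets [] = here refl
  ∈-signedSets (y ∷ X) = ∈-cartesianProductWith⁺ _∷_ (∈-signed y) (∈-signedSets X)

  length-∈-signedSets : ∀ k {X} → X ∈ signedSets k → length X ≡ k
  length-∈-signedSets zero (here refl) = refl
  length-∈-signedSets (suc k) X∈ with ∈-cartesianProductWith⁻ _∷_ signed (signedSets k) X∈
  ... | _ , _ , _ , Y∈ , refl = cong suc (length-∈-signedSets k Y∈)

  length-signedSets : ∀ k → length (signedSets k) ≡ (m * 2) ^ k
  length-signedSets zero = refl
  length-signedSets (suc k) = trans (length-cartesianProductWith _∷_ signed (signedSets k))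
    (cong₂ _*_ (trans (length-cartesianProductWith _,_ (allFin m) (true ∷ false ∷ [])) (cong (_* 2) (length-tabulate {n = m} id)))
      (length-signedSets k))

-- Rich tournaments by the union bound

Rich : ∀ {m} → OGraph m → ℕ → Set
Rich {m} H k = ∀ X → Unique (map proj₁ X) → length X ≡ k → k ≤ length (agreeing H X)

-- By `gain`, a given X fails with probability at most 9^r / 2^c; by `union`, (2m)^k such failures
-- cannot cover all outcomes.
module UnionBound (m : ℕ) {a c r : ℕ} .{{_ : NonZero a}} (a+8 : a + 8 ≡ 9 * 2 ^ suc r)
  (gain : ∀ ℓ → m ≤ suc r + ℓ → 2 ^ c * a ^ ℓ ≤ (a + 8) ^ ℓ)
  (union : (m * 2) ^ suc r * 9 ^ r < 2 ^ c) where

  open Random m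

  Ω = allBits (m * m)
  k = suc r
  unique? : ∀ (X : List (Fin m × Bool)) → Dec (Unique (map proj₁ X))
  unique? X = allPairs? (λ x y → ¬? (x ≟ y)) (map proj₁ X)
  events : List (List (Fin m × Bool))
  events = filter unique? (signedSets k)
  total : Bits → ℕ
  total b = ∑ events (λ X → few k X b)
  each : ∀ {X} → X ∈ events → 2 ^ c * 𝔼 (few k X) ≤ 9 ^ r * 2 ^ (m * m)
  each {X} X∈ with ∈-filter⁻ unique? {xs = signedSets k} X∈
  ... | X∈′ , uniq with length-∈-signedSets k X∈′
  ... | len = 𝔼-few {a} {c} {r} X (trans a+8 (cong (λ z → 9 * 2 ^ z) (sym len)))
                (λ ℓ le → gain ℓ (subst (λ z → m ≤ z + ℓ) len le)) uniq
  bound : 2 ^ c * 𝔼 total < 2 ^ c * 2 ^ (m * m)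
  bound = begin-strict
    2 ^ c * 𝔼 total
      ≡⟨ cong (2 ^ c *_) (∑-swap (λ b X → few k X b) Ω events) ⟩
    2 ^ c * ∑ events (λ X → 𝔼 (few k X))
      ≡⟨ sym (∑-* (2 ^ c) (λ X → 𝔼 (few k X)) events) ⟩
    ∑ events (λ X → 2 ^ c * 𝔼 (few k X))
      ≤⟨ ∑-≤-length _ events each ⟩
    length events * (9 ^ r * 2 ^ (m * m))
      ≤⟨ *-monoˡ-≤ _ (≤-trans (length-filter unique? (signedSets k)) (≤-reflexive (length-signedSets k))) ⟩
    (m * 2) ^ k * (9 ^ r * 2 ^ (m * m))
      ≡⟨ sym (*-assoc ((m * 2) ^ k) _ _) ⟩
    (m * 2) ^ k * 9 ^ r * 2 ^ (m * m)
      <⟨ *-monoˡ-< (2 ^ (m * m)) {{m^n≢0 2 (m * m)}} union ⟩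
    2 ^ c * 2 ^ (m * m) ∎
    where open ≤-Reasoning
  total< : 𝔼 total < length Ω
  total< = subst (𝔼 total <_) (sym (length-allBits (m * m))) (*-cancelˡ-< (2 ^ c) _ _ bound)

  ∃-rich : Σ (OGraph m) λ H → Rich H (suc r)
  ∃-rich with ∑<length⇒∃zero total Ω total<
  ... | b , total≡0 = tournament b , λ X uniq len →
    few≡0⇒≤ k X b (n≤0⇒n≡0 (≤-trans
      (∑-member-≤ (λ X → few k X b) events
        (∈-filter⁺ unique? (subst (λ z → X ∈ signedSets z) len (∈-signedSets X)) uniq))
      (≤-reflexive total≡0)))

agreeing-unique : ∀ {m} (H : OGraph m) X → Unique (agreeing H X)
agreeing-unique {m} H X = Unique.filter⁺ (T? ∘ agreesAll H X) (Unique.allFin⁺ m)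

∈-agreeing⁻ : ∀ {m} (H : OGraph m) X {v} → v ∈ agreeing H X → T (agreesAll H X v)
∈-agreeing⁻ H X v∈ = proj₂ (∈-filter⁻ (T? ∘ agreesAll H X) {xs = allFin _} v∈)

-- The two lists are disjoint because H has no opposite arcs. Only an inequality holds, as y itself
-- and vertices not adjacent to y are in neither.
length-agreeing-split : ∀ {m} (H : OGraph m) X y →
  length (agreeing H ((y , true) ∷ X)) + length (agreeing H ((y , false) ∷ X)) ≤ length (agreeing H X)
length-agreeing-split H X y = subst (_≤ length (agreeing H X)) (length-++ A⁺)
  (length-≤-⊆ (Unique.++⁺ (agreeing-unique H ((y , true) ∷ X)) (agreeing-unique H ((y , false) ∷ X)) disjoint)
    (λ v∈ → sub (∈-++⁻ A⁺ v∈)))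
  where
  A⁺ = agreeing H ((y , true) ∷ X)
  disjoint : ∀ {v} → ¬ (v ∈ agreeing H ((y , true) ∷ X) × v ∈ agreeing H ((y , false) ∷ X))
  disjoint {v} (p , q)
    with () ← trans (sym (noOpp H v y (agreesAll-∈ H ((y , true) ∷ X) {v} (∈-agreeing⁻ H ((y , true) ∷ X) p) (here refl))))
                    (agreesAll-∈ H ((y , false) ∷ X) {v} (∈-agreeing⁻ H ((y , false) ∷ X) q) (here refl))
  weaken : ∀ s {v} → v ∈ agreeing H ((y , s) ∷ X) → v ∈ agreeing H X
  weaken s {v} v∈ = ∈-filter⁺ (T? ∘ agreesAll H X) (∈-allFin v)
    (proj₂ (Equivalence.to (T-∧ {agrees H v (y , s)}) (∈-agreeing⁻ H ((y , s) ∷ X) v∈)))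
  sub : ∀ {v} → v ∈ agreeing H ((y , true) ∷ X) ⊎ v ∈ agreeing H ((y , false) ∷ X) → v ∈ agreeing H X
  sub (inj₁ p) = weaken true p
  sub (inj₂ p) = weaken false p

-- Splitting by the arc to a vertex outside X doubles the count for each element missing from X.
rich-doubling : ∀ {m k} (H : OGraph m) → Rich H k → k ≤ m → ∀ j X → Unique (map proj₁ X) →
  length X + j ≡ k → 2 ^ j * k ≤ length (agreeing H X)
rich-doubling {k = k} H rich k≤m zero X uniq len =
  ≤-trans (≤-reflexive (+-identityʳ k)) (rich X uniq (trans (sym (+-identityʳ _)) len))
rich-doubling {m} {k} H rich k≤m (suc j) X uniq len
  with longer⇒∃∉ {xs = allFin m} {ys = map proj₁ X} (Unique.allFin⁺ m) shorter
  where
  open ≤-Reasoning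
  shorter : length (map proj₁ X) < length (allFin m)
  shorter = begin-strict
    length (map proj₁ X) ≡⟨ length-map proj₁ X ⟩
    length X             <⟨ m<m+n (length X) (s≤s z≤n) ⟩
    length X + suc j     ≡⟨ len ⟩
    k                    ≤⟨ k≤m ⟩
    m                    ≡⟨ sym (length-tabulate id) ⟩
    length (allFin m)    ∎
... | y , _ , y∉ = begin
  2 * 2 ^ j * k             ≡⟨ lemma (2 ^ j) k ⟩
  2 ^ j * k + 2 ^ j * k     ≤⟨ +-mono-≤ (extend true) (extend false) ⟩
  length (agreeing H ((y , true) ∷ X)) + length (agreeing H ((y , false) ∷ X))
                            ≤⟨ length-agreeing-split H X y ⟩
  length (agreeing H X)     ∎
  where
  open ≤-Reasoning
  lemma : ∀ p k → 2 * p * k ≡ p * k + p * k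
  lemma = solve-∀
  extend : ∀ s → 2 ^ j * k ≤ length (agreeing H ((y , s) ∷ X))
  extend s = rich-doubling H rich k≤m j ((y , s) ∷ X)
    (All.tabulate (λ x∈ → λ { refl → y∉ x∈ }) ∷ uniq) (trans (sym (+-suc _ j)) len)

-- Greedy colouring

unique-map-injectiveOn : ∀ {A B : Set} (f : A → B) {xs} → Unique xs →
  (∀ {x y} → x ∈ xs → y ∈ xs → f x ≡ f y → x ≡ y) → Unique (map f xs)
unique-map-injectiveOn f [] _ = []
unique-map-injectiveOn f {x ∷ xs} (x∉ ∷ uniq) inj =
  All.tabulate fresh ∷ unique-map-injectiveOn f uniq (λ p q → inj (there p) (there q))
  where
  fresh : ∀ {y} → y ∈ map f xs → f x ≢ y
  fresh y∈ refl with ∈-map⁻ f y∈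
  ... | x′ , x′∈ , e = All.lookup x∉ x′∈ (inj (here refl) (there x′∈) e)

-- Any vertex map under which no two arcs become opposite is a homomorphism
-- to the image of G; arcs between equally coloured vertices are excluded too,
-- by taking the same arc twice.
noOpposite⇒OColourable : ∀ {n k} (G : OGraph n) (ψ : Fin n → Fin k) →
  (∀ {x y x′ y′} → arc G x y ≡ true → arc G y′ x′ ≡ true → ψ x ≡ ψ x′ → ψ y ≡ ψ y′ → ⊥) →
  OColourable G k
noOpposite⇒OColourable {n} {k} G ψ noOpp′ = H , ψ , hom
  where
  ImageArc : Fin k → Fin k → Set
  ImageArc a b = ∃₂ λ x y → arc G x y ≡ true × ψ x ≡ a × ψ y ≡ b
  imageArc? : ∀ a b → Dec (ImageArc a b)
  imageArc? a b = any? λ x → any? λ y → (arc G x y Bool.≟ true) ×-dec (ψ x ≟ a) ×-dec (ψ y ≟ b)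
  ¬opposite : ∀ {a b} → ImageArc a b → ¬ ImageArc b a
  ¬opposite (x , y , xy , refl , refl) (y′ , x′ , y′x′ , e , e′) = noOpp′ xy y′x′ (sym e′) (sym e)
  loop : ∀ a → does (imageArc? a a) ≡ false
  loop a with imageArc? a a
  ... | yes p = contradiction p (¬opposite p)
  ... | no _ = refl
  opp : ∀ a b → does (imageArc? a b) ≡ true → does (imageArc? b a) ≡ false
  opp a b _ with imageArc? a b | imageArc? b a
  ... | yes p | yes q = contradiction q (¬opposite p)
  ... | _ | no _ = refl
  H : OGraph k
  H = record { arc = λ a b → does (imageArc? a b) ; noLoop = loop ; noOpp = opp }
  hom : IsHom G H ψ
  hom x y xy = dec-true (imageArc? (ψ x) (ψ y)) (x , y , xy , refl , refl)

-- Orders that leave an uncoloured neighbour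

nbrs : ∀ {n} → OGraph n → Fin n → List (Fin n)
nbrs {n} G x = filterᵇ (adj G x) (allFin n)

module _ {n} (G : OGraph n) where
  open import Data.List.Membership.DecPropositional (_≟_ {n}) using (_∈?_)

  adj-sym : ∀ {x y} → adj G x y ≡ true → adj G y x ≡ true
  adj-sym {x} {y} = trans (∨-comm (arc G y x) (arc G x y))

  arc⇒adj : ∀ {x y} → arc G x y ≡ true → adj G x y ≡ true
  arc⇒adj xy rewrite xy = refl

  ¬adj-refl : ∀ {x} → adj G x x ≢ true
  ¬adj-refl {x} e rewrite noLoop G x with () ← e

  ∈-nbrs⁺ : ∀ {x y} → adj G x y ≡ true → y ∈ nbrs G x
  ∈-nbrs⁺ {x} {y} e = ∈-filter⁺ (T? ∘ adj G x) (∈-allFin y) (Equivalence.from T-≡ e)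

  ∈-nbrs⁻ : ∀ {x y} → y ∈ nbrs G x → adj G x y ≡ true
  ∈-nbrs⁻ {x} y∈ = Equivalence.to T-≡ (proj₂ (∈-filter⁻ (T? ∘ adj G x) {xs = allFin n} y∈))

  nbrs-unique : ∀ x → Unique (nbrs G x)
  nbrs-unique x = Unique.filter⁺ (T? ∘ adj G x) (Unique.allFin⁺ n)

  -- Colouring from the head, every vertex still has an uncoloured neighbour when its turn comes.
  data Core : List (Fin n) → Set where
    edge : ∀ {u v} → adj G u v ≡ true → Core (u ∷ v ∷ [])
    grow : ∀ {x z L} → x ∉ L → z ∈ L → adj G x z ≡ true → Core L → Core (x ∷ L)

  -- Serves the count of forbidden colours: an uncoloured neighbour of the current vertex has a
  -- further uncoloured neighbour.
  core-nbr : ∀ {L z} → Core L → z ∈ L → ∃ λ z′ → z′ ∈ L × adj G z z′ ≡ true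
  core-nbr (edge uv) (here refl) = _ , there (here refl) , uv
  core-nbr (edge uv) (there (here refl)) = _ , here refl , adj-sym uv
  core-nbr (grow _ z∈ xz core) (here refl) = _ , there z∈ , xz
  core-nbr (grow _ _ _ core) (there z∈) with core-nbr core z∈
  ... | z′ , z′∈ , zz′ = z′ , there z′∈ , zz′

  core-unique : ∀ {L} → Core L → Unique L
  core-unique (edge uv) = ((λ { refl → ¬adj-refl uv }) ∷ []) ∷ [] ∷ []
  core-unique (grow x∉ _ _ core) = All.tabulate (λ z∈ → λ { refl → x∉ z∈ }) ∷ core-unique core

  core-inhabited : ∀ {L} → Core L → ∃ (_∈ L)
  core-inhabited (edge _) = _ , here refl
  core-inhabited (grow _ _ _ _) = _ , here refl

  crossing : ∀ {L x z} → Reachable G x z → x ∉ L → z ∈ L →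
    ∃₂ λ a b → a ∉ L × b ∈ L × adj G a b ≡ true
  crossing here x∉ x∈ = contradiction x∈ x∉
  crossing {L} (step {v = v} xv path) x∉ z∈ with v ∈? L
  ... | yes v∈ = _ , v , x∉ , v∈ , xv
  ... | no v∉ = crossing path v∉ z∈

  spanning-core : Connected G → ∀ fuel {L} → Core L → n ≤ fuel + length L →
    ∃ λ L′ → Core L′ × (∀ x → x ∈ L′)
  spanning-core conn fuel {L} core enough with any? (λ x → ¬? (x ∈? L))
  ... | no ¬p = L , core , λ x → decidable-stable (x ∈? L) (λ x∉ → ¬p (x , x∉))
  -- Without fuel, x together with L would be more than n distinct vertices.
  spanning-core conn zero {L} core enough | yes (x , x∉) = contradiction
    (≤-trans (length-≤-⊆ {ys = allFin n} (All.tabulate (λ z∈ → λ { refl → x∉ z∈ }) ∷ core-unique core) (λ _ → ∈-allFin _))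
      (≤-reflexive (length-tabulate {n = n} id)))
    (<⇒≱ (s≤s enough))
  spanning-core conn (suc fuel) {L} core enough | yes (x , x∉)
    with z , z∈ ← core-inhabited core
    with a , b , a∉ , b∈ , ab ← crossing (conn x z) x∉ z∈ =
    spanning-core conn fuel (grow a∉ b∈ ab core)
      (≤-trans enough (≤-reflexive (sym (+-suc fuel (length L)))))

-- The need of the greedy step for Δ = r + 2: X holds the colours of the coloured neighbours, at
-- most j + 1 neighbours are uncoloured, and each of these forbids at most r colours.
Abundant : ∀ {m} → OGraph m → ℕ → Set
Abundant H r = ∀ X j → Unique (map proj₁ X) → length X + j ≡ suc r →
  suc j * r < length (agreeing H X)

module Colouring {n m r} (G : OGraph n) (H : OGraph m) (deg≤ : ∀ x → deg G x ≤ suc (suc r))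
  (abundant : Abundant H r) where
  open import Data.List.Membership.DecPropositional (_≟_ {n}) using (_∈?_)

  -- The invariant, with L the uncoloured vertices; the values of c on L are arbitrary. `sep`
  -- ensures that the constraints on a vertex still to be coloured name distinct colours.
  record Good (L : List (Fin n)) (c : Fin n → Fin m) : Set where
    field
      hom : ∀ {x y} → x ∉ L → y ∉ L → arc G x y ≡ true → arc H (c x) (c y) ≡ true
      sep : ∀ {z x y} → z ∈ L → x ∉ L → y ∉ L → adj G z x ≡ true → adj G z y ≡ true →
        c x ≡ c y → x ≡ y
  open Good

  module Extend {L x z₀} {c : Fin n → Fin m} (core : Core G L) (x∉L : x ∉ L)
    (z₀∈L : z₀ ∈ L) (xz₀ : adj G x z₀ ≡ true) (good : Good (x ∷ L) c) where

    uncoloured? : ∀ y → Dec (y ∈ x ∷ L)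
    uncoloured? y = y ∈? (x ∷ L)

    coloured : Fin n → List (Fin n)
    coloured z = filter (¬? ∘ uncoloured?) (nbrs G z)

    uncoloured : List (Fin n)
    uncoloured = filter uncoloured? (nbrs G x)

    ∈-coloured⁻ : ∀ {z y} → y ∈ coloured z → adj G z y ≡ true × y ∉ x ∷ L
    ∈-coloured⁻ {z} y∈ with ∈-filter⁻ (¬? ∘ uncoloured?) {xs = nbrs G z} y∈
    ... | y∈nbrs , y∉ = ∈-nbrs⁻ G y∈nbrs , y∉

    ∈-coloured⁺ : ∀ {z y} → adj G z y ≡ true → y ∉ x ∷ L → y ∈ coloured z
    ∈-coloured⁺ zy = ∈-filter⁺ (¬? ∘ uncoloured?) (∈-nbrs⁺ G zy)

    coloured-unique : ∀ z → Unique (coloured z)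
    coloured-unique z = Unique.filter⁺ (¬? ∘ uncoloured?) (nbrs-unique G z)

    ∈-uncoloured⁻ : ∀ {z} → z ∈ uncoloured → z ∈ L × adj G x z ≡ true
    ∈-uncoloured⁻ z∈ with ∈-filter⁻ uncoloured? {xs = nbrs G x} z∈
    ... | z∈nbrs , here refl = ⊥-elim (¬adj-refl G (∈-nbrs⁻ G z∈nbrs))
    ... | z∈nbrs , there z∈L = z∈L , ∈-nbrs⁻ G z∈nbrs

    ∈-uncoloured⁺ : ∀ {z} → z ∈ L → adj G x z ≡ true → z ∈ uncoloured
    ∈-uncoloured⁺ z∈L xz = ∈-filter⁺ uncoloured? (∈-nbrs⁺ G xz) (there z∈L)

    -- For a neighbour y of x, a false `arc G x y` means an arc from y to x, so the sign is the
    -- direction required between the new colour and `c y`.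
    constraints : List (Fin m × Bool)
    constraints = map (λ y → c y , arc G x y) (coloured x)

    constraints-unique : Unique (map proj₁ constraints)
    constraints-unique = subst Unique (map-∘ (coloured x))
      (unique-map-injectiveOn c (coloured-unique x) λ p q →
        let xy , y∉ = ∈-coloured⁻ p ; xy′ , y′∉ = ∈-coloured⁻ q
        in sep good (here refl) y∉ y′∉ xy xy′)

    -- Colours seen from x through an uncoloured neighbour; reusing one would break `sep`.
    forbidden : List (Fin m)
    forbidden = concatMap (map c ∘ coloured) uncoloured

    -- x and an uncoloured neighbour of z are two neighbours of z not counted here.
    length-coloured : ∀ {z} → z ∈ uncoloured → length (map c (coloured z)) ≤ r
    length-coloured {z} z∈ with ∈-uncoloured⁻ z∈
    ... | z∈L , xz with core-nbr G core z∈L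
    ... | z′ , z′∈L , zz′ = ≤-trans (≤-reflexive (length-map c (coloured z)))
      (s≤s⁻¹ (s≤s⁻¹ (≤-trans (length-≤-⊆ {xs = x ∷ z′ ∷ coloured z} uniq sub) (deg≤ z))))
      where
      uniq : Unique (x ∷ z′ ∷ coloured z)
      uniq = ((λ { refl → x∉L z′∈L }) ∷ All.tabulate (λ y∈ e → proj₂ (∈-coloured⁻ y∈) (here (sym e))))
           ∷ All.tabulate (λ { y∈ refl → proj₂ (∈-coloured⁻ y∈) (there z′∈L) })
           ∷ coloured-unique z
      sub : ∀ {y} → y ∈ x ∷ z′ ∷ coloured z → y ∈ nbrs G z
      sub (here refl) = ∈-nbrs⁺ G (adj-sym G xz)
      sub (there (here refl)) = ∈-nbrs⁺ G zz′
      sub (there (there y∈)) = ∈-nbrs⁺ G (proj₁ (∈-coloured⁻ y∈))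

    unc≥1 : 1 ≤ length uncoloured
    unc≥1 = length-≤-⊆ {xs = z₀ ∷ []} ([] ∷ []) λ { (here refl) → ∈-uncoloured⁺ z₀∈L xz₀ }

    degree-split : length uncoloured + length (coloured x) ≤ suc (suc r)
    degree-split = ≤-trans (≤-reflexive (length-filter-∁ uncoloured? (nbrs G x))) (deg≤ x)

    ∃-allowed : ∃ λ γ → γ ∈ agreeing H constraints × γ ∉ forbidden
    -- The uncoloured neighbour `z₀` leaves at most r + 1 coloured ones. The shortfall from r + 1 is
    -- j, so at most j + 1 neighbours are uncoloured.
    ∃-allowed with m≤n⇒∃[o]m+o≡n (s≤s⁻¹ (≤-trans (+-monoˡ-≤ (length (coloured x)) unc≥1) degree-split))
    ... | j , |col|+j≡1+r = longer⇒∃∉ (agreeing-unique H constraints) (begin-strict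
      length forbidden        ≤⟨ length-concatMap-≤ (map c ∘ coloured) uncoloured length-coloured ⟩
      length uncoloured * r   ≤⟨ *-monoˡ-≤ r unc≤ ⟩
      suc j * r               <⟨ abundant constraints j constraints-unique len ⟩
      length (agreeing H constraints) ∎)
      where
      open ≤-Reasoning
      len : length constraints + j ≡ suc r
      len = trans (cong (_+ j) (length-map _ (coloured x))) |col|+j≡1+r
      unc≤ : length uncoloured ≤ suc j
      unc≤ = +-cancelʳ-≤ (length (coloured x)) _ _ (≤-trans degree-split
        (≤-reflexive (cong suc (trans (sym |col|+j≡1+r) (+-comm (length (coloured x)) j)))))

    γ : Fin m
    γ = proj₁ ∃-allowed

    c′ : Fin n → Fin m
    c′ w with w ≟ x
    ... | yes _ = γ
    ... | no _ = c w

    γ-agrees : ∀ {y} → adj G x y ≡ true → y ∉ x ∷ L → agrees H γ (c y , arc G x y) ≡ true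
    γ-agrees xy y∉ = agreesAll-∈ H constraints (∈-agreeing⁻ H constraints (proj₁ (proj₂ ∃-allowed)))
      (∈-map⁺ (λ y → c y , arc G x y) (∈-coloured⁺ xy y∉))

    γ-out : ∀ {y} → arc G x y ≡ true → y ∉ x ∷ L → arc H γ (c y) ≡ true
    γ-out xy y∉ with γ-agrees (arc⇒adj G xy) y∉
    ... | e rewrite xy = e

    γ-in : ∀ {y} → arc G y x ≡ true → y ∉ x ∷ L → arc H (c y) γ ≡ true
    γ-in {y} yx y∉ with γ-agrees (adj-sym G (arc⇒adj G yx)) y∉
    ... | e rewrite noOpp G y x yx = e

    γ-fresh : ∀ {z y} → z ∈ L → adj G z x ≡ true → adj G z y ≡ true → y ∉ x ∷ L → γ ≢ c y
    γ-fresh z∈L zx zy y∉ e = proj₂ (proj₂ ∃-allowed)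
      (subst (_∈ forbidden) (sym e) (∈-concatMap⁺ (map c ∘ coloured)
        (lose (∈-uncoloured⁺ z∈L (adj-sym G zx)) (∈-map⁺ c (∈-coloured⁺ zy y∉)))))

    ∉-cons : ∀ {y} → y ≢ x → y ∉ L → y ∉ x ∷ L
    ∉-cons y≢x y∉ (here e) = y≢x e
    ∉-cons y≢x y∉ (there y∈) = y∉ y∈

    good′ : Good L c′
    hom good′ {a} {b} a∉ b∉ ab with a ≟ x | b ≟ x
    ... | yes refl | yes refl = contradiction (arc⇒adj G ab) (¬adj-refl G)
    ... | yes refl | no b≢ = γ-out ab (∉-cons b≢ b∉)
    ... | no a≢ | yes refl = γ-in ab (∉-cons a≢ a∉)
    ... | no a≢ | no b≢ = hom good (∉-cons a≢ a∉) (∉-cons b≢ b∉) ab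
    sep good′ {z} {a} {b} z∈ a∉ b∉ za zb e with a ≟ x | b ≟ x
    ... | yes refl | yes refl = refl
    ... | yes refl | no b≢ = contradiction e (γ-fresh z∈ za zb (∉-cons b≢ b∉))
    ... | no a≢ | yes refl = contradiction (sym e) (γ-fresh z∈ zb za (∉-cons a≢ a∉))
    ... | no a≢ | no b≢ = sep good (there z∈) (∉-cons a≢ a∉) (∉-cons b≢ b∉) za zb e

  colour-down : ∀ {L c} → Core G L → Good L c → ∃₂ λ u v → ∃ (Good (u ∷ v ∷ []))
  colour-down (edge {u} {v} _) good = u , v , _ , good
  colour-down (grow x∉ z∈ xz core) good = colour-down core (Extend.good′ core x∉ z∈ xz good)

  -- A private colour belongs to u or v alone. If opposite image arcs meet there, their other ends
  -- agree, by `sep` unless also private, so G would have opposite arcs; otherwise H would.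
  complete : ∀ {u v c} → Good (u ∷ v ∷ []) c → OColourable G (m + 2)
  complete {u} {v} {c} good = noOpposite⇒OColourable G ψ noOpposite
    where
    L = u ∷ v ∷ []
    ψ₀ : Fin n → Fin m ⊎ Fin 2
    ψ₀ w with w ≟ u | w ≟ v
    ... | yes _ | _ = inj₂ Fin.zero
    ... | no _ | yes _ = inj₂ (Fin.suc Fin.zero)
    ... | no _ | no _ = inj₁ (c w)
    ψ : Fin n → Fin (m + 2)
    ψ w = join m 2 (ψ₀ w)
    outside-L : ∀ {w} → w ≢ u → w ≢ v → w ∉ L
    outside-L w≢u w≢v (here e) = w≢u e
    outside-L w≢u w≢v (there (here e)) = w≢v e
    SameClass : Fin n → Fin n → Set
    SameClass w w′ = w ≡ w′ ⊎ (w ∉ L × w′ ∉ L × c w ≡ c w′)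
    ψ₀-classes : ∀ w w′ → ψ₀ w ≡ ψ₀ w′ → SameClass w w′
    ψ₀-classes w w′ e with w ≟ u | w ≟ v | w′ ≟ u | w′ ≟ v
    ... | yes refl | _ | yes refl | _ = inj₁ refl
    ... | yes refl | _ | no _ | yes refl with () ← e
    ... | yes refl | _ | no _ | no _ with () ← e
    ... | no _ | yes refl | yes refl | _ with () ← e
    ... | no _ | yes refl | no _ | yes refl = inj₁ refl
    ... | no _ | yes refl | no _ | no _ with () ← e
    ... | no _ | no _ | yes refl | _ with () ← e
    ... | no _ | no _ | no _ | yes refl with () ← e
    ... | no p | no q | no p′ | no q′ = inj₂ (outside-L p q , outside-L p′ q′ , inj₁-injective e)
    classes : ∀ {w w′} → ψ w ≡ ψ w′ → SameClass w w′
    classes {w} {w′} e = ψ₀-classes w w′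
      (trans (sym (splitAt-join m 2 (ψ₀ w))) (trans (cong (splitAt m) e) (splitAt-join m 2 (ψ₀ w′))))
    ¬opposite : ∀ {k} (K : OGraph k) {a b} → arc K a b ≡ true → arc K b a ≢ true
    ¬opposite K {a} {b} ab ba with () ← trans (sym ba) (noOpp K a b ab)
    inH : ∀ {x y x′ y′} → x ∉ L → y ∉ L → x′ ∉ L → y′ ∉ L → c x ≡ c x′ → c y ≡ c y′ →
      arc G x y ≡ true → arc G y′ x′ ≡ true → ⊥
    inH x∉ y∉ x′∉ y′∉ ex ey xy y′x′ = ¬opposite H (hom good x∉ y∉ xy)
      (subst₂ (λ a b → arc H a b ≡ true) (sym ey) (sym ex) (hom good y′∉ x′∉ y′x′))
    noOpposite : ∀ {x y x′ y′} → arc G x y ≡ true → arc G y′ x′ ≡ true → ψ x ≡ ψ x′ → ψ y ≡ ψ y′ → ⊥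
    noOpposite {x} {y} {x′} {y′} xy y′x′ ex ey with classes {x} {x′} ex | classes {y} {y′} ey
    ... | inj₁ refl | inj₁ refl = ¬opposite G xy y′x′
    ... | inj₂ (x∉ , x′∉ , e) | inj₂ (y∉ , y′∉ , e′) = inH x∉ y∉ x′∉ y′∉ e e′ xy y′x′
    ... | inj₁ refl | inj₂ (y∉ , y′∉ , e) with x ∈? L
    ...   | no x∉ = inH x∉ y∉ x∉ y′∉ refl e xy y′x′
    ...   | yes x∈ with refl ← sep good x∈ y∉ y′∉ (arc⇒adj G xy) (adj-sym G (arc⇒adj G y′x′)) e =
      ¬opposite G xy y′x′
    noOpposite {x} {y} {x′} {y′} xy y′x′ ex ey | inj₂ (x∉ , x′∉ , e) | inj₁ refl with y ∈? L
    ...   | no y∉ = inH x∉ y∉ x′∉ y∉ e refl xy y′x′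
    ...   | yes y∈ with refl ← sep good y∈ x∉ x′∉ (adj-sym G (arc⇒adj G xy)) (arc⇒adj G y′x′) e =
      ¬opposite G xy y′x′

  connected⇒OColourable : Connected G → ∀ {u v} → adj G u v ≡ true → Fin m → OColourable G (m + 2)
  connected⇒OColourable conn uv c₀
    with L , core , full ← spanning-core G conn n (edge uv) (m≤m+n n 2)
    -- Every vertex starts uncoloured: the invariant holds vacuously and `c₀` is a placeholder.
    with _ , _ , _ , good ← colour-down {c = λ _ → c₀} core
           (record { hom = λ {x} x∉ _ _ → contradiction (full x) x∉
                   ; sep = λ {_} {x} _ x∉ _ _ _ _ → contradiction (full x) x∉ }) =
    complete good

-- Doubling outpaces the linear number of forbidden colours, since j + 1 ≤ 2^j.
rich⇒abundant : ∀ {m r} (H : OGraph m) → Rich H (suc r) → suc r ≤ m → Abundant H r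
rich⇒abundant {r = r} H rich k≤m X j uniq len = begin-strict
  suc j * r       <⟨ *-monoʳ-< (suc j) (n<1+n r) ⟩
  suc j * suc r   ≤⟨ *-monoˡ-≤ (suc r) (n<2^n j) ⟩
  2 ^ j * suc r   ≤⟨ rich-doubling H rich k≤m j X uniq len ⟩
  length (agreeing H X) ∎
  where
  open ≤-Reasoning

-- The number of colours

-- Lets 2^s absorb a polynomial factor while s stays below about e / 2. Raising e by 2 raises s by
-- 1, hence two base cases: at e = 26 and 27 the left side is 13104 and 14094, against 2^14 = 16384.
exponent : ∀ d e → d + 26 ≡ e → ∃ λ s → s + s ≤ 2 + e × 18 * (e * (2 + e)) ≤ 2 ^ s
exponent zero _ refl = 14 , ≤ᵇ⇒≤ _ _ _ , ≤ᵇ⇒≤ _ _ _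
exponent (suc zero) _ refl = 14 , ≤ᵇ⇒≤ _ _ _ , ≤ᵇ⇒≤ _ _ _
exponent (suc (suc d)) (suc (suc e)) d+26≡e with exponent d e (suc-injective (suc-injective d+26≡e))
... | s , 2s≤ , le = suc s , ≤-trans (≤-reflexive (cong suc (+-suc s s))) (s≤s (s≤s 2s≤)) , (begin
  18 * ((2 + e) * (4 + e)) ≤⟨ *-monoʳ-≤ 18 (*-monoʳ-≤ (2 + e) (+-monoˡ-≤ e 4≤e)) ⟩
  18 * ((2 + e) * (e + e)) ≡⟨ lemma e ⟩
  2 * (18 * (e * (2 + e))) ≤⟨ *-monoʳ-≤ 2 le ⟩
  2 * 2 ^ s                ∎)
  where
  open ≤-Reasoning
  4≤e : 4 ≤ e
  4≤e = ≤-trans (≤ᵇ⇒≤ 4 26 _) (≤-trans (m≤n+m 26 d) (≤-reflexive (suc-injective (suc-injective d+26≡e))))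
  lemma : ∀ e → 18 * ((2 + e) * (e + e)) ≡ 2 * (18 * (e * (2 + e)))
  lemma = solve-∀

-- Provides 9 p + 1 ≤ 16 e for p = 3 + e + s. Doubling brings in the bound on `s + s`, and 74 ≤ 5 e
-- is what remains.
exponent-slack : ∀ {e s} → 26 ≤ e → s + s ≤ 2 + e → 9 * (3 + e + s) + 1 ≤ 16 * e
exponent-slack {e} {s} 26≤e 2s≤ = *-cancelˡ-≤ 2 (begin
  2 * (9 * (3 + e + s) + 1)        ≡⟨ lemma₁ e s ⟩
  9 * (s + s) + (56 + 18 * e)      ≤⟨ +-monoˡ-≤ (56 + 18 * e) (*-monoʳ-≤ 9 2s≤) ⟩
  9 * (2 + e) + (56 + 18 * e)      ≡⟨ lemma₂ e ⟩
  74 + 27 * e                      ≤⟨ +-monoˡ-≤ (27 * e) (≤-trans (≤ᵇ⇒≤ 74 (5 * 26) _) (*-monoʳ-≤ 5 26≤e)) ⟩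
  5 * e + 27 * e                   ≡⟨ lemma₃ e ⟩
  2 * (16 * e)                     ∎)
  where
  open ≤-Reasoning
  lemma₁ : ∀ e s → 2 * (9 * (3 + e + s) + 1) ≡ 9 * (s + s) + (56 + 18 * e)
  lemma₁ = solve-∀
  lemma₂ : ∀ e → 9 * (2 + e) + (56 + 18 * e) ≡ 74 + 27 * e
  lemma₂ = solve-∀
  lemma₃ : ∀ e → 5 * e + 27 * e ≡ 2 * (16 * e)
  lemma₃ = solve-∀

-- With e = Δ - 3 and so k = 2 + e.
colours : ℕ → ℕ
colours e = e * (2 + e) * 2 ^ (3 + e)

∃-exponent : ∀ {e} → 26 ≤ e → ∃ λ s → 9 * (3 + e + s) + 1 ≤ 16 * e × 18 * (e * (2 + e)) ≤ 2 ^ s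
∃-exponent {e} 26≤e =
  let s , 2s≤ , le = exponent (e ∸ 26) e (m∸n+n≡m 26≤e) in s , exponent-slack {e} {s} 26≤e 2s≤ , le

k≤colours : ∀ {e} → 26 ≤ e → 2 + e ≤ colours e
k≤colours {e} 26≤e = begin
  2 + e                 ≡⟨ sym (*-identityˡ (2 + e)) ⟩
  1 * (2 + e)           ≤⟨ *-monoˡ-≤ (2 + e) (≤-trans (s≤s z≤n) 26≤e) ⟩
  e * (2 + e)           ≡⟨ sym (*-identityʳ _) ⟩
  e * (2 + e) * 1       ≤⟨ *-monoʳ-≤ (e * (2 + e)) (m^n>0 2 (3 + e)) ⟩
  colours e             ∎
  where open ≤-Reasoning

-- By Bernoulli, every 9 (1 + P) = (9/8) 2^k vertices outside a signed k-set halve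
-- the expected weight; p k halvings beat the (2m)^k 9^k of the union bound.
∃-abundant-of-size : ∀ {m r p P} → 8 * (1 + P) ≡ 2 ^ suc r → suc r ≤ m →
  suc r + 9 * (1 + P) * (p * suc r) ≤ m → m * 2 * 9 ≤ 2 ^ p →
  Σ (OGraph m) λ H → Abundant H r
∃-abundant-of-size {m} {r} {p} {P} 8P k≤m room 18m≤ = proj₁ ∃H , rich⇒abundant (proj₁ ∃H) (proj₂ ∃H) k≤m
  where
  open ≤-Reasoning
  k = suc r
  -- This is 9 * 2^k - 8, because 2^k = 8 (1 + P).
  a = 8 * (8 + 9 * P)
  a+8≡72[1+P] : ∀ P → 8 * (8 + 9 * P) + 8 ≡ 9 * (8 * (1 + P))
  a+8≡72[1+P] = solve-∀
  9*8 : ∀ P → 9 * (8 * (1 + P)) ≡ (9 * (1 + P)) * 8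
  9*8 = solve-∀
  a+8 : a + 8 ≡ 9 * 2 ^ k
  a+8 = trans (a+8≡72[1+P] P) (cong (9 *_) 8P)
  a≤ : a ≤ (9 * (1 + P)) * 8
  a≤ = ≤-trans (m≤m+n a 8) (≤-reflexive (trans (a+8≡72[1+P] P) (9*8 P)))
  gain : ∀ ℓ → m ≤ k + ℓ → 2 ^ (p * k) * a ^ ℓ ≤ (a + 8) ^ ℓ
  gain ℓ m≤ = 2^c*a^ℓ≤[a+w]^ℓ {a} {8} {9 * (1 + P)} (p * k) ℓ a≤
    (+-cancelˡ-≤ k _ _ (≤-trans room m≤))
  m*2≢0 : NonZero (m * 2)
  m*2≢0 = m*n≢0 m 2 {{>-nonZero (≤-trans (s≤s z≤n) k≤m)}}
  union : (m * 2) ^ k * 9 ^ r < 2 ^ (p * k)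
  union = begin-strict
    (m * 2) ^ k * 9 ^ r <⟨ *-monoʳ-< ((m * 2) ^ k) {{m^n≢0 (m * 2) k {{m*2≢0}}}} (^-monoʳ-< 9 (s≤s (s≤s z≤n)) (n<1+n r)) ⟩
    (m * 2) ^ k * 9 ^ k ≡⟨ sym (^-distribʳ-* k (m * 2) 9) ⟩
    (m * 2 * 9) ^ k     ≤⟨ ^-monoˡ-≤ k 18m≤ ⟩
    (2 ^ p) ^ k         ≡⟨ ^-*-assoc 2 p k ⟩
    2 ^ (p * k)         ∎
  ∃H : Σ (OGraph m) λ H → Rich H k
  ∃H = UnionBound.∃-rich m {a} {p * k} {r} a+8 gain union

2^k≡8[1+P] : ∀ {e} → 1 ≤ e → ∃ λ P → 8 * (1 + P) ≡ 2 ^ (2 + e)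
2^k≡8[1+P] {suc f} _ with m≤n⇒∃[o]m+o≡n (m^n>0 2 f)
... | P , 1+P≡2^f = P , trans (cong (8 *_) 1+P≡2^f) (lemma (2 ^ f))
  where
  lemma : ∀ Q → 8 * Q ≡ 2 * (2 * (2 * Q))
  lemma = solve-∀

room∧size⇒∃-abundant : ∀ {e s P} → 26 ≤ e → 9 * (3 + e + s) + 1 ≤ 16 * e →
  18 * (e * (2 + e)) ≤ 2 ^ s → 8 * (1 + P) ≡ 2 ^ (2 + e) →
  Σ (OGraph (colours e)) λ H → Abundant H (suc e)
room∧size⇒∃-abundant {e} {s} {P} 26≤e slack 18ek≤ 8P =
  ∃-abundant-of-size {p = p} {P} 8P (k≤colours 26≤e) room 18m≤
  where
  open ≤-Reasoning
  k = 2 + e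
  -- Here 2 ^ (3 + e) covers the power of two in `colours e`, and 2^s covers the factor 18 e (2 +
  -- e).
  p = 3 + e + s
  room : k + 9 * (1 + P) * (p * k) ≤ colours e
  room = begin
    k + 9 * (1 + P) * (p * k)             ≤⟨ +-monoˡ-≤ _ (m≤m*n k (1 + P)) ⟩
    k * (1 + P) + 9 * (1 + P) * (p * k)   ≡⟨ lemma₁ k P p ⟩
    (9 * p + 1) * (k * (1 + P))           ≤⟨ *-monoˡ-≤ (k * (1 + P)) slack ⟩
    16 * e * (k * (1 + P))                ≡⟨ lemma₂ e k P ⟩
    e * k * (2 * (8 * (1 + P)))           ≡⟨ cong (λ z → e * k * (2 * z)) 8P ⟩
    colours e                             ∎
    where
    lemma₁ : ∀ k P p → k * (1 + P) + 9 * (1 + P) * (p * k) ≡ (9 * p + 1) * (k * (1 + P))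
    lemma₁ = solve-∀
    lemma₂ : ∀ e k P → 16 * e * (k * (1 + P)) ≡ e * k * (2 * (8 * (1 + P)))
    lemma₂ = solve-∀
  18m≤ : colours e * 2 * 9 ≤ 2 ^ p
  18m≤ = begin
    colours e * 2 * 9                     ≡⟨ lemma (e * k) (2 ^ (3 + e)) ⟩
    2 ^ (3 + e) * (18 * (e * k))          ≤⟨ *-monoʳ-≤ (2 ^ (3 + e)) 18ek≤ ⟩
    2 ^ (3 + e) * 2 ^ s                   ≡⟨ sym (^-distribˡ-+-* 2 (3 + e) s) ⟩
    2 ^ p                                 ∎
    where
    lemma : ∀ x y → x * y * 2 * 9 ≡ y * (18 * x)
    lemma = solve-∀

abstract
  ∃-abundant : ∀ {e} → 26 ≤ e → Σ (OGraph (colours e)) λ H → Abundant H (suc e)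
  ∃-abundant {e} 26≤e =
    let s , slack , 18ek≤ = ∃-exponent 26≤e
        P , 8P = 2^k≡8[1+P] (≤-trans (s≤s z≤n) 26≤e)
    in room∧size⇒∃-abundant {e} {s} {P} 26≤e slack 18ek≤ 8P

∃-nbr : ∀ {n} (G : OGraph n) {Δ} u → deg G u ≡ suc Δ → ∃ λ v → v ∈ nbrs G u
∃-nbr G u d with nbrs G u
∃-nbr G u () | []
... | v ∷ _ = v , here refl

upper-bound : ∀ {e} → 26 ≤ e → ∀ n (G : OGraph n) → Connected G → MaxDegree G (3 + e) →
  OColourable G (colours e + 2)
upper-bound {e} 26≤e n G conn (deg≤ , u , deg≡)
  with H , abundant ← ∃-abundant 26≤e
  with v , v∈ ← ∃-nbr G u deg≡ =
  Colouring.connected⇒OColourable G H deg≤ abundant conn (∈-nbrs⁻ G v∈)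
    (fromℕ< (≤-trans (s≤s z≤n) (k≤colours 26≤e)))

-- The lower bound

funToFin-cong : ∀ {m n} {f g : Fin m → Fin n} → (∀ i → f i ≡ g i) → funToFin f ≡ funToFin g
funToFin-cong {zero} _ = refl
funToFin-cong {suc m} e = cong₂ combine (e zero) (funToFin-cong (e ∘ suc))

-- Choosing preimages under a surjection would inject `Fin N` into `Fin M`.
∃-missed : ∀ {M N} (f : Fin M → Fin N) → M < N → ∃ λ y → ∀ x → f x ≢ y
∃-missed {M} {N} f M<N with all? (λ y → any? (λ x → f x ≟ y))
... | yes surj = contradiction (injective⇒≤ inj) (<⇒≱ M<N)
  where
  inj : ∀ {y y′} → proj₁ (surj y) ≡ proj₁ (surj y′) → y ≡ y′
  inj {y} {y′} e = trans (sym (proj₂ (surj y))) (trans (cong f e) (proj₂ (surj y′)))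
... | no ¬surj with ¬∀⟶∃¬ N _ (λ y → any? (λ x → f x ≟ y)) ¬surj
... | y , ¬hit = y , λ x e → ¬hit (x , e)

∃-√ : ∀ {N} → 0 < N → ∃ λ K → K * K < N × (∀ k → k * k < N → k ≤ K)
-- The search descends from N, a valid bound because k ≤ k² < N.
∃-√ {N} 0<N = search N λ k k²<N → <⇒≤ (≤-<-trans (m≤m² k) k²<N)
  where
  m≤m² : ∀ k → k ≤ k * k
  m≤m² zero = z≤n
  m≤m² k@(suc _) = m≤m*n k k
  search : ∀ b → (∀ k → k * k < N → k ≤ b) → ∃ λ K → K * K < N × (∀ k → k * k < N → k ≤ K)
  search b bound with b * b <? N
  ... | yes b²<N = b , b²<N , bound
  search zero bound | no b²≮N = contradiction 0<N b²≮N
  search (suc b) bound | no b²≮N = search b λ k k²<N →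
    s≤s⁻¹ (≤∧≢⇒< (bound k k²<N) λ { refl → b²≮N k²<N })

module _ {n} (G : OGraph n) where
  reachable-trans : ∀ {u v w} → Reachable G u v → Reachable G v w → Reachable G u w
  reachable-trans here q = q
  reachable-trans (step uv p) q = step uv (reachable-trans p q)

  reachable-sym : ∀ {u v} → Reachable G u v → Reachable G v u
  reachable-sym here = here
  reachable-sym (step uv p) = reachable-trans (reachable-sym p) (step (adj-sym G uv) here)

-- The strip graph

shift : ∀ {n′ D′} → Fin (suc n′) → Fin (2 + D′) → Fin (suc n′ + suc D′)
shift i t = fromℕ< (+-mono-<-≤ (toℕ<n i) (s≤s⁻¹ (toℕ<n t)))

toℕ-shift : ∀ {n′ D′} i t → toℕ (shift {n′} {D′} i t) ≡ toℕ i + toℕ t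
toℕ-shift i t = toℕ-fromℕ< _

-- A strip: left vertex i is joined to the right vertices i, …, i + D, and the
-- bit o i t orients the edge from i to i + t.
module Strip (n′ D′ : ℕ) (o : Fin (suc n′) → Fin (2 + D′) → Bool) where
  n = suc n′
  -- Since D ≥ 1, the offsets 0 and 1 both exist, which connects the strip.
  D = suc D′

  Offset : Fin n → Fin (n + D) → Set
  Offset i j = ∃ λ (t : Fin (suc D)) → toℕ i + toℕ t ≡ toℕ j

  offset? : ∀ i j → Dec (Offset i j)
  offset? i j = any? λ t → (toℕ i + toℕ t) ℕ.≟ toℕ j

  arcLR arcRL : Fin n → Fin (n + D) → Bool
  arcLR i j with offset? i j
  ... | yes (t , _) = o i t
  ... | no _ = false
  arcRL i j with offset? i j
  ... | yes (t , _) = not (o i t)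
  ... | no _ = false

  arc⊎ : Fin n ⊎ Fin (n + D) → Fin n ⊎ Fin (n + D) → Bool
  arc⊎ (inj₁ i) (inj₂ j) = arcLR i j
  arc⊎ (inj₂ j) (inj₁ i) = arcRL i j
  arc⊎ _ _ = false

  arc⊎-irrefl : ∀ u → arc⊎ u u ≡ false
  arc⊎-irrefl (inj₁ _) = refl
  arc⊎-irrefl (inj₂ _) = refl

  arc⊎-asym : ∀ u v → arc⊎ u v ≡ true → arc⊎ v u ≡ false
  arc⊎-asym (inj₁ i) (inj₂ j) e with offset? i j
  ... | yes (t , _) rewrite e = refl
  arc⊎-asym (inj₂ j) (inj₁ i) e with offset? i j
  ... | yes (t , _) with o i t
  ...   | false = refl

  V : ℕ
  V = n + (n + D)

  G : OGraph V
  G = record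
    { arc = λ u v → arc⊎ (splitAt n u) (splitAt n v)
    ; noLoop = λ u → arc⊎-irrefl (splitAt n u)
    ; noOpp = λ u v → arc⊎-asym (splitAt n u) (splitAt n v)
    }

  left : Fin n → Fin V
  left i = i ↑ˡ (n + D)

  right : Fin (n + D) → Fin V
  right j = n ↑ʳ j

  offset-unique : ∀ {i j t} → toℕ i + toℕ t ≡ toℕ j → (s : Offset i j) → proj₁ s ≡ t
  offset-unique {i} e (t′ , e′) = toℕ-injective (+-cancelˡ-≡ (toℕ i) _ _ (trans e′ (sym e)))

  arc-LR : ∀ {i j t} → toℕ i + toℕ t ≡ toℕ j → arc G (left i) (right j) ≡ o i t
  arc-LR {i} {j} {t} e rewrite splitAt-↑ˡ n i (n + D) | splitAt-↑ʳ n (n + D) j with offset? i j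
  ... | yes s = cong (o i) (offset-unique {i} {j} e s)
  ... | no ¬s = contradiction (t , e) ¬s

  arc-RL : ∀ {i j t} → toℕ i + toℕ t ≡ toℕ j → arc G (right j) (left i) ≡ not (o i t)
  arc-RL {i} {j} {t} e rewrite splitAt-↑ˡ n i (n + D) | splitAt-↑ʳ n (n + D) j with offset? i j
  ... | yes s = cong (not ∘ o i) (offset-unique {i} {j} e s)
  ... | no ¬s = contradiction (t , e) ¬s

  adj-LR : ∀ {i j t} → toℕ i + toℕ t ≡ toℕ j → adj G (left i) (right j) ≡ true
  adj-LR {i} {j} {t} e rewrite arc-LR {i} {j} {t} e | arc-RL {i} {j} {t} e with o i t
  ... | true = refl
  ... | false = refl

  data Side : Fin V → Set where
    isLeft  : ∀ i → Side (left i)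
    isRight : ∀ j → Side (right j)

  side : ∀ u → Side u
  side u = subst Side (join-splitAt n (n + D) u) (side⊎ (splitAt n u))
    where
    side⊎ : ∀ s → Side (join n (n + D) s)
    side⊎ (inj₁ i) = isLeft i
    side⊎ (inj₂ j) = isRight j

  -- an arbitrary value when no left vertex has offset t to j
  unshift : Fin (n + D) → Fin (suc D) → Fin n
  unshift j t = pick (any? λ i → (toℕ i + toℕ t) ℕ.≟ toℕ j)
    where
    pick : Dec (∃ λ i → toℕ i + toℕ t ≡ toℕ j) → Fin n
    pick (yes (i , _)) = i
    pick (no _) = zero

  unshift-offset : ∀ {i j t} → toℕ i + toℕ t ≡ toℕ j → unshift j t ≡ i
  unshift-offset {i} {j} {t} e with any? {n} (λ i → (toℕ i + toℕ t) ℕ.≟ toℕ j)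
  ... | yes (i′ , e′) = toℕ-injective (+-cancelʳ-≡ (toℕ t) (toℕ i′) (toℕ i) (trans e′ (sym e)))
  ... | no ¬s = contradiction (i , e) ¬s

  -- A superset of the neighbours of the right length: near the ends of the strip some entries are
  -- spurious, which an upper bound on the degree tolerates.
  candidates : ∀ {u} → Side u → List (Fin V)
  candidates (isLeft i) = map (right ∘ shift i) (allFin (suc D))
  candidates (isRight j) = map (left ∘ unshift j) (allFin (suc D))

  length-candidates : ∀ {u} (s : Side u) → length (candidates s) ≡ suc D
  length-candidates (isLeft i) = trans (length-map (right ∘ shift i) (allFin (suc D))) (length-tabulate {n = suc D} id)
  length-candidates (isRight j) = trans (length-map (left ∘ unshift j) (allFin (suc D))) (length-tabulate {n = suc D} id)

  adj⇒offset : ∀ i j → arcLR i j ∨ arcRL i j ≡ true → Offset i j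
  adj⇒offset i j e with offset? i j
  ... | yes s = s

  adj⇒candidate : ∀ {u v} (s : Side u) → Side v → adj G u v ≡ true → v ∈ candidates s
  adj⇒candidate (isLeft i) (isLeft i′) e
    rewrite splitAt-↑ˡ n i (n + D) | splitAt-↑ˡ n i′ (n + D) with () ← e
  adj⇒candidate (isRight j) (isRight j′) e
    rewrite splitAt-↑ʳ n (n + D) j | splitAt-↑ʳ n (n + D) j′ with () ← e
  adj⇒candidate (isLeft i) (isRight j) e
    rewrite splitAt-↑ˡ n i (n + D) | splitAt-↑ʳ n (n + D) j with adj⇒offset i j e
  ... | t , eq = subst (λ z → right z ∈ candidates (isLeft i)) (toℕ-injective (trans (toℕ-shift i t) eq))
    (∈-map⁺ (right ∘ shift i) (∈-allFin t))
  adj⇒candidate (isRight j) (isLeft i) adj-e with adj-sym G {right j} {left i} adj-e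
  ... | e rewrite splitAt-↑ˡ n i (n + D) | splitAt-↑ʳ n (n + D) j with adj⇒offset i j e
  ... | t , eq = subst (λ z → left z ∈ candidates (isRight j)) (unshift-offset {i} {j} {t} eq)
    (∈-map⁺ (left ∘ unshift j) (∈-allFin t))

  deg≤ : ∀ u → deg G u ≤ suc D
  deg≤ u = ≤-trans (length-≤-⊆ (nbrs-unique G u) (λ {v} v∈ → adj⇒candidate (side u) (side v) (∈-nbrs⁻ G {u} {v} v∈)))
    (≤-reflexive (length-candidates (side u)))

  right-injective : ∀ {j j′} → right j ≡ right j′ → j ≡ j′
  right-injective = ↑ʳ-injective n _ _

  deg-left : deg G (left zero) ≡ suc D
  deg-left = ≤-antisym (deg≤ (left zero)) (≤-trans (≤-reflexive (sym (length-tabulate {n = suc D} id)))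
    (length-≤-injectiveOn (right ∘ shift zero) {ys = nbrs G (left zero)} (Unique.allFin⁺ (suc D)) inj
      (λ {t} _ → ∈-nbrs⁺ G {left zero} {right (shift zero t)} (adj-LR {zero} {shift zero t} {t} (sym (toℕ-shift zero t))))))
    where
    inj : ∀ {t t′} → t ∈ allFin (suc D) → t′ ∈ allFin (suc D) →
      right (shift zero t) ≡ right (shift zero t′) → t ≡ t′
    inj {t} {t′} _ _ e = toℕ-injective (trans (sym (toℕ-shift zero t))
      (trans (cong toℕ (right-injective e)) (toℕ-shift zero t′)))

  maxDegree : MaxDegree G (suc D)
  maxDegree = deg≤ , left zero , deg-left

  -- Left vertices i and i + 1 share the right neighbour i + 1, at offsets 1 and 0.
  left-reaches : ∀ i → Reachable G (left i) (left zero)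
  left-reaches = <-weakInduction (λ i → Reachable G (left i) (left zero)) here λ i p →
    let j = shift (inject₁ i) (suc zero) in
    step (adj-LR {suc i} {j} {zero} (offset₀ i))
      (step (adj-sym G {left (inject₁ i)} {right j} (adj-LR {inject₁ i} {j} {suc zero} (sym (toℕ-shift (inject₁ i) (suc zero))))) p)
    where
    offset₀ : ∀ (i : Fin n′) → suc (toℕ i) + 0 ≡ toℕ (shift (inject₁ i) (suc zero))
    offset₀ i = sym (trans (toℕ-shift (inject₁ i) (suc zero))
      (trans (cong (_+ 1) (toℕ-inject₁ i)) (trans (+-suc (toℕ i) 0) refl)))

  right-reaches : ∀ j → Reachable G (right j) (left zero)
  right-reaches j with toℕ j <? n
  ... | yes j<n = step (adj-sym G {left i} {right j} (adj-LR {i} {j} {zero} (trans (+-identityʳ _) (toℕ-fromℕ< j<n)))) (left-reaches i)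
    where i = fromℕ< j<n
  -- Right vertices from n on hang on the last left vertex n′, at offset j - n′ ≤ D.
  ... | no j≮n = step (adj-sym G {left i} {right j} (adj-LR {i} {j} {t} offset)) (left-reaches i)
    where
    i = fromℕ n′
    n′≤j : n′ ≤ toℕ j
    n′≤j = ≤-trans (n≤1+n n′) (≮⇒≥ j≮n)
    t<1+D : toℕ j ∸ n′ < suc D
    t<1+D = ≤-trans (∸-monoˡ-< (toℕ<n j) n′≤j) (≤-reflexive (trans (cong (_∸ n′) (sym (+-suc n′ D))) (m+n∸m≡n n′ (suc D))))
    t = fromℕ< t<1+D
    offset : toℕ i + toℕ t ≡ toℕ j
    offset = trans (cong₂ _+_ (toℕ-fromℕ n′) (toℕ-fromℕ< t<1+D)) (m+[n∸m]≡n n′≤j)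

  connected : Connected G
  connected u v = reachable-trans G (reaches u) (reachable-sym G (reaches v))
    where
    reaches : ∀ u → Reachable G u (left zero)
    reaches u with side u
    ... | isLeft i = left-reaches i
    ... | isRight j = right-reaches j

  -- A false bit means that the arc of G runs from right to left; its image excludes the opposite
  -- arc in H.
  hom-determines : ∀ {k} (H : OGraph k) {φ} → IsHom G H φ → ∀ i t →
    arc H (φ (left i)) (φ (right (shift i t))) ≡ o i t
  hom-determines H hom i t with o i t in eq
  ... | true = hom _ _ (trans (arc-LR {i} {shift i t} {t} (sym (toℕ-shift i t))) eq)
  ... | false = noOpp H _ _ (hom _ _ (trans (arc-RL {i} {shift i t} {t} (sym (toℕ-shift i t))) (cong not eq)))

-- Counting the orientations that small targets allow

toBool : Fin 2 → Bool
toBool zero = false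
toBool (suc zero) = true

fromBool : Bool → Fin 2
fromBool false = zero
fromBool true = suc zero

fromBool-toBool : ∀ x → fromBool (toBool x) ≡ x
fromBool-toBool zero = refl
fromBool-toBool (suc zero) = refl

-- A map to at most K vertices and the arcs between them determine E bits, but
-- there are too few such data to produce every orientation.
module Counting {V E K : ℕ} (tail head : Fin E → Fin V) where

  decodeWith : (Fin (K * K) → Fin 2) → (Fin V → Fin K) → Fin (2 ^ E)
  decodeWith M φ = funToFin λ x → M (combine (φ (tail x)) (φ (head x)))

  decode : Fin (2 ^ (K * K) * K ^ V) → Fin (2 ^ E)
  decode c = let M , φ = remQuot {2 ^ (K * K)} (K ^ V) c in decodeWith (finToFun M) (finToFun φ)

  decode-combine : ∀ M φ → decode (combine (funToFin M) (funToFin φ)) ≡ decodeWith M φ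
  decode-combine M φ = trans
    (cong (λ (M , φ) → decodeWith (finToFun M) (finToFun φ))
      (remQuot-combine {2 ^ (K * K)} {K ^ V} (funToFin M) (funToFin φ)))
    (funToFin-cong {E} λ x → trans (finToFun-funToFin M _)
      (cong M (cong₂ combine (finToFun-funToFin φ (tail x)) (finToFun-funToFin φ (head x)))))

  -- A target on k vertices is padded with d isolated ones, so that a single count at K covers every
  -- k ≤ K.
  map⇒decode : ∀ o {k} → k ≤ K → (A : Fin k → Fin k → Bool) (φ : Fin V → Fin k) →
    (∀ x → A (φ (tail x)) (φ (head x)) ≡ toBool (finToFun o x)) → ∃ λ c → decode c ≡ o
  map⇒decode o {k} k≤K A φ determines with m≤n⇒∃[o]m+o≡n k≤K
  ... | d , refl = combine (funToFin M) (funToFin φ′) ,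
    trans (decode-combine M φ′) (trans (funToFin-cong {E} pointwise) (funToFin-finToFin {E} {2} o))
    where
    A⊎ : Fin k ⊎ Fin d → Fin k ⊎ Fin d → Bool
    A⊎ (inj₁ a) (inj₁ b) = A a b
    A⊎ _ _ = false
    M : Fin (K * K) → Fin 2
    M y = let a , b = remQuot {K} K y in fromBool (A⊎ (splitAt k a) (splitAt k b))
    φ′ : Fin V → Fin K
    φ′ u = φ u ↑ˡ d
    M-φ′ : ∀ u v → M (combine (φ′ u) (φ′ v)) ≡ fromBool (A (φ u) (φ v))
    M-φ′ u v = trans
      (cong (λ (a , b) → fromBool (A⊎ (splitAt k a) (splitAt k b))) (remQuot-combine {K} {K} (φ′ u) (φ′ v)))
      (cong₂ (λ a b → fromBool (A⊎ a b)) (splitAt-↑ˡ k (φ u) d) (splitAt-↑ˡ k (φ v) d))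
    pointwise : ∀ x → M (combine (φ′ (tail x)) (φ′ (head x))) ≡ finToFun o x
    pointwise x = trans (M-φ′ (tail x) (head x))
      (trans (cong fromBool (determines x)) (fromBool-toBool _))

  ∃-undetermined : 2 ^ (K * K) * K ^ V < 2 ^ E → ∃ λ (o : Fin E → Bool) →
    ∀ {k} → k ≤ K → (A : Fin k → Fin k → Bool) (φ : Fin V → Fin k) →
    ¬ (∀ x → A (φ (tail x)) (φ (head x)) ≡ o x)
  ∃-undetermined lt with ∃-missed decode lt
  ... | o , missed = toBool ∘ finToFun o , λ k≤K A φ determines →
    let c , e = map⇒decode o k≤K A φ determines in missed c e

-- With a = 2 ^ (D + 1) - 1, lengthening the strip by one multiplies the orientations by a + 1 but
-- the colourings only by K² ≤ a, so ((a + 1) / a)^n outgrows the constant c.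
∃-long : ∀ D K → K * K < 2 ^ suc D →
  ∃ λ n′ → 2 ^ (K * K) * K ^ (suc n′ + (suc n′ + D)) < 2 ^ (suc n′ * suc D)
∃-long D K K²<Q with m≤n⇒∃[o]m+o≡n (≤-trans (s≤s (s≤s z≤n)) (^-monoʳ-≤ 2 {1} {suc D} (s≤s z≤n)))
... | a′ , 2+a′≡Q = n′ , (begin-strict
  2 ^ (K * K) * K ^ (n + (n + D))        ≡⟨ cong (2 ^ (K * K) *_) (trans (^-distribˡ-+-* K n (n + D)) (cong (K ^ n *_) (^-distribˡ-+-* K n D))) ⟩
  2 ^ (K * K) * (K ^ n * (K ^ n * K ^ D)) ≡⟨ lemma (2 ^ (K * K)) (K ^ n) (K ^ D) ⟩
  c * (K ^ n * K ^ n)                    ≡⟨ cong (c *_) (sym (^-distribʳ-* n K K)) ⟩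
  c * (K * K) ^ n                        ≤⟨ *-monoʳ-≤ c (^-monoˡ-≤ n K²≤a) ⟩
  c * a ^ n                              <⟨ *-monoˡ-< (a ^ n) {{m^n≢0 a n}} (<-trans (n<1+n c) (n<2^n (suc c))) ⟩
  2 ^ suc c * a ^ n                      ≤⟨ 2^c*a^ℓ≤[a+w]^ℓ {a} {1} {a} (suc c) n (≤-reflexive (sym (*-identityʳ a))) ≤-refl ⟩
  (a + 1) ^ n                            ≡⟨ cong (_^ n) a+1≡Q ⟩
  (2 ^ suc D) ^ n                        ≡⟨ ^-*-assoc 2 (suc D) n ⟩
  2 ^ (suc D * n)                        ≡⟨ cong (2 ^_) (*-comm (suc D) n) ⟩
  2 ^ (n * suc D)                        ∎)
  where
  open ≤-Reasoning
  a = suc a′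
  c = 2 ^ (K * K) * K ^ D
  -- Makes n equal to a * (c + 1): Bernoulli with w = 1 gives c + 1 doublings of a factors each, and
  -- c < 2 ^ (c + 1).
  n′ = c + a′ * suc c
  n = suc n′
  a+1≡Q : a + 1 ≡ 2 ^ suc D
  a+1≡Q = trans (+-comm a 1) 2+a′≡Q
  K²≤a : K * K ≤ a
  K²≤a = s≤s⁻¹ (≤-trans K²<Q (≤-reflexive (sym 2+a′≡Q)))
  lemma : ∀ x y z → x * (y * (y * z)) ≡ x * z * (y * y)
  lemma = solve-∀

-- K is the largest number with square below 2^Δ. A target with k² < 2^Δ has k ≤ K, yet would
-- recover an orientation chosen so that no target of that size does.
lower-bound : ∀ D′ → let Δ = 2 + D′ in
  Σ ℕ λ n → Σ (OGraph n) λ G → Connected G × MaxDegree G Δ ×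
    ((k : ℕ) → OColourable G k → TwoPowHalf≤ Δ k)
lower-bound D′
  with K , K²<Q , K-max ← ∃-√ (m^n>0 2 (2 + D′))
  with n′ , lt ← ∃-long (suc D′) K K²<Q
  with o , bad ← Counting.∃-undetermined {K = K}
    (λ x → let i , _ = remQuot {suc n′} (2 + D′) x in i ↑ˡ (suc n′ + suc D′))
    (λ x → let i , t = remQuot {suc n′} (2 + D′) x in suc n′ ↑ʳ shift {n′} {D′} i t) lt =
  V , G , connected , maxDegree , λ k (H , φ , hom) → ≮⇒≥ λ k²<Q → bad (K-max k k²<Q) (arc H) φ λ x →
    let i , t = remQuot {suc n′} (2 + D′) x in
    trans (hom-determines H {φ} hom i t) (cong o (combine-remQuot {suc n′} (2 + D′) x))
  where open Strip n′ D′ (λ i t → o (combine i t))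

theorem3 : (Δ : ℕ) → 29 ≤ Δ →
    (Σ ℕ λ n → Σ (OGraph n) λ G → Connected G × MaxDegree G Δ ×
    ((k : ℕ) → OColourable G k → TwoPowHalf≤ Δ k))
    × ((n : ℕ) (G : OGraph n) → Connected G → MaxDegree G Δ →
    OColourable G ((Δ ∸ 3) * (Δ ∸ 1) * 2 ^ Δ + 2))
-- With Δ = 3 + e, the factors Δ - 3 and Δ - 1 compute to e and 2 + e, as in `colours e`.
theorem3 (suc (suc (suc e))) (s≤s (s≤s (s≤s 26≤e))) = lower-bound (suc e) , upper-bound 26≤e
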